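{- Let $s\geq 2$ be an integer and let $q$ be an integer with $0\leq q \leq 2\binom{s}{2}$. Then: \begin{itemize} \item if $0\leq q< \binom{s}{2}$ and $n\geq s$, then $\mathrm{ex}_{\Pi}(n,s,q)=0$; \item if $q=\binom{s}{2}$ and $n\geq s$, then $\mathrm{ex}_{\Pi}(n,s,q)=1$; \item if $\binom{s}{2} < q < \binom{s}{2}+ \lfloor s/2\rfloor$ and $n\geq s$, then $\mathrm{ex}_{\Pi}(n,s,q)=2^{q-\binom{s}{2}}$; \item if $\binom{s}{2}+ \lfloor s/2\rfloor \leq q < \binom{s}{2}+ s-2$, then $\mathrm{ex}_{\Pi}(n,s,q)=2^{\Theta(n)}$ as $n\to\infty$; \item if $q = \binom{s}{2}+ s-2$ and $n\geq s$, then $\mathrm{ex}_{\Pi}(n,s,q)=2^{\lfloor \frac{s-2}{s-1}n\rfloor}$; \item if $q = \binom{s}{2}+ s-1$ and $n\geq s$, then $\mathrm{ex}_{\Pi}(n,s,q)=2^{\mathrm{ex}(n, \{C_3, C_4, \ldots, C_{s}\})}$; \item if $\binom{s}{2}+ s\leq q< \binom{s}{2}+ \lfloor s^2/4\rfloor$, then $\mathrm{ex}_{\Pi}(n,s,q)=2^{o(n^2)}$ as $n\to\infty$; \item if $\binom{s}{2}+\lfloor s^2/4\rfloor \leq q \leq 2\binom{s}{2}$, then $\mathrm{ex}_{\Pi}(n,s,q)=2^{\Theta(n^2)}$ as $n\to\infty$. \end{itemize}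
   Context: A multigraph is a pair $G=(V,w)$ where $V$ is a finite set and $w:\binom{V}{2}\to\mathbb{Z}_{\geq 0}$. For $X\subseteq V$ write $e(G[X])=\sum_{xy\in\binom{X}{2}}w(xy)$ and $P(G)=\prod_{xy\in\binom{V}{2}}w(xy)$. Given integers $s\geq 2$, $q\geq 0$, $\mathcal{F}(n,s,q)$ denotes the set of multigraphs on vertex set $[n]=\{1,\dots,n\}$ in which every $s$-set $X$ of vertices satisfies $e(G[X])\leq q$, and $\mathrm{ex}_{\Pi}(n,s,q)=\max\{P(G): G\in\mathcal{F}(n,s,q)\}$. $\mathrm{ex}(n,\{C_3,\dots,C_s\})$ is the maximum number of edges in an $n$-vertex (simple) graph containing no cycle of length $\ell$ for any $3\le \ell\le s$ (i.e. of girth at least $s+1$). -}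

module Defs where

open import Data.Nat using (ℕ; zero; suc; _+_; _*_; _∸_; _^_; _≤_; _<_; _/_; _<ᵇ_)
open import Data.Bool using (Bool; true; false; if_then_else_; _∧_)
open import Data.Fin using (Fin; toℕ; inject₁; fromℕ) renaming (zero to fzero; suc to fsuc)
open import Data.Fin.Subset using (Subset; ∣_∣)
open import Data.Vec using (lookup)
open import Data.List using (List; []; _∷_; concatMap; allFin; map)
open import Data.Nat.ListAction using (sum; product)
open import Data.Product using (Σ; _×_; _,_; ∃)
open import Data.Empty using (⊥)
open import Relation.Nullary using (¬_)
open import Relation.Binary.PropositionalEquality using (_≡_)
open import Function.Definitions using (Injective)

-- Floor division, with the (unused) convention m / 0 = 0.
divFloor : ℕ → ℕ → ℕ
divFloor m zero = 0
divFloor m (suc k) = m / suc k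

pairs : (n : ℕ) → List (Fin n × Fin n)
pairs n = concatMap (λ i → concatMap (λ j → if toℕ i <ᵇ toℕ j then (i , j) ∷ [] else []) (allFin n)) (allFin n)

-- A multigraph on [n]: w i j is the multiplicity of the pair {i,j}; only entries with i < j are used.
Multigraph : ℕ → Set
Multigraph n = Fin n → Fin n → ℕ

eInd : {n : ℕ} → Multigraph n → Subset n → ℕ
eInd {n} w X = sum (map (λ p → if lookup X (Data.Product.proj₁ p) ∧ lookup X (Data.Product.proj₂ p) then w (Data.Product.proj₁ p) (Data.Product.proj₂ p) else 0) (pairs n))

P : {n : ℕ} → Multigraph n → ℕ
P {n} w = product (map (λ p → w (Data.Product.proj₁ p) (Data.Product.proj₂ p)) (pairs n))

InF : (n s q : ℕ) → Multigraph n → Set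
InF n s q w = (X : Subset n) → ∣ X ∣ ≡ s → eInd w X ≤ q

IsExΠ : (n s q m : ℕ) → Set
IsExΠ n s q m = (Σ (Multigraph n) λ w → InF n s q w × P w ≡ m) × ((w : Multigraph n) → InF n s q w → P w ≤ m)

record SimpleGraph (n : ℕ) : Set where
  field
    adj : Fin n → Fin n → Bool
    sym : ∀ i j → adj i j ≡ adj j i
    irrefl : ∀ i → adj i i ≡ false
open SimpleGraph public

edges : {n : ℕ} → SimpleGraph n → ℕ
edges {n} G = sum (map (λ p → if adj G (Data.Product.proj₁ p) (Data.Product.proj₂ p) then 1 else 0) (pairs n))

Cycle : {n : ℕ} → SimpleGraph n → ℕ → Set
Cycle G zero = ⊥
Cycle {n} G (suc k) = Σ (Fin (suc k) → Fin n) λ v → Injective _≡_ _≡_ v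
  × ((i : Fin k) → adj G (v (inject₁ i)) (v (fsuc i)) ≡ true)
  × adj G (v (fromℕ k)) (v fzero) ≡ true

NoShortCycles : {n : ℕ} → ℕ → SimpleGraph n → Set
NoShortCycles s G = (ℓ : ℕ) → 3 ≤ ℓ → ℓ ≤ s → ¬ Cycle G ℓ

IsExCycles : (n s m : ℕ) → Set
IsExCycles n s m = (Σ (SimpleGraph n) λ G → NoShortCycles s G × edges G ≡ m)
  × ((G : SimpleGraph n) → NoShortCycles s G → edges G ≤ m)

{-# OPTIONS --safe #-}
-- A multigraph of positive product has weights 1 + f, where the excess f sums to at most
-- t = q − C(s,2) over every s-set, and P ≤ 2^(Σ f) with equality when f ≤ 1.  So everything is
-- about the maximal total excess e(V).
--
-- If t < ⌊s/2⌋, then t + 1 units of excess would already fit into an s-set, so e(V) ≤ t.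
--
-- For t = s − 2 and t = s − 1, explore the components of the support of f one after the other: as
-- long as none of them is a tree, each new vertex brings a new edge, except possibly the first
-- vertex of the last component, so s vertices span at least s − 1 edges.  For t = s − 2 this
-- produces a tree component of fewer than s vertices, which is removed.  For t = s − 1, after
-- pruning vertices of degree at most 1, every small dense set lies in a small component with as
-- many edges as vertices, which is replaced by pendant vertices (or the whole graph by one long
-- cycle), so that the girth exceeds s.
--
-- For t < ⌊s²/4⌋ the support contains no K_{⌊s/2⌋,⌈s/2⌉}, hence has o(n²) edges, and from
-- t = ⌊s²/4⌋ on a balanced complete bipartite graph of excess 1 is allowed.
--
-- Vertex sets are duplicate-free lists, deg f x ys is the total weight between x and ys, and
-- e f xs is the total weight inside xs.

module Submission where

open import Defs hiding (sym)
open import Data.Bool using (Bool; true; false; if_then_else_; not; _∧_; _xor_; T)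
open import Data.Bool.Properties using (T?)
open import Data.Fin using (Fin; zero; suc; toℕ; inject₁; fromℕ) renaming (_<_ to _<ᶠ_)
import Data.Fin.Properties as Fin
open import Data.Fin.Subset using (Subset; ∣_∣)
open import Data.Fin.Subset.Properties using (anySubset?)
open import Data.List using (List; []; _∷_; [_]; _++_; map; concatMap; length; filter; take; lookup; tabulate; allFin; upTo; downFrom)
open import Data.List.Properties using (++-assoc; length-++; length-map; length-tabulate; length-take; length-upTo; length-downFrom; map-∘; map-tabulate; take++drop≡id)
open import Data.List.Membership.Propositional using (_∈_; _∉_; find; lose)
open import Data.List.Membership.Propositional.Properties using (∈-++⁺ˡ; ∈-++⁺ʳ; ∈-++⁻; ∈-∃++; ∈-map⁺; ∈-filter⁺; ∈-filter⁻; ∈-concatMap⁺; ∈-concatMap⁻; ∈-tabulate⁺; ∈-allFin; ∈-lookup; ∈-upTo⁺; ∈-upTo⁻; ∈-downFrom⁺)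
open import Data.List.Relation.Binary.Permutation.Propositional using (_↭_; refl; prep; swap; trans; ↭-sym; ↭-refl; ↭-trans)
open import Data.List.Relation.Binary.Permutation.Propositional.Properties using (↭-length; shift; ∈-resp-↭; All-resp-↭; map⁺; ++-comm)
open import Data.List.Relation.Binary.Sublist.Propositional using (_⊆_; []; _∷_; _∷ʳ_)
open import Data.List.Relation.Binary.Sublist.Propositional.Properties using (All-resp-⊆; Any-resp-⊆; filter-⊆)
open import Data.List.Relation.Unary.All as All using (All; []; _∷_)
import Data.List.Relation.Unary.All.Properties as All
open import Data.List.Relation.Unary.AllPairs as AllPairs using (AllPairs; []; _∷_)
import Data.List.Relation.Unary.AllPairs.Properties as AllPairs
open import Data.List.Relation.Unary.Any as Any using (Any; here; there; any?)
import Data.List.Relation.Unary.Any.Properties as Any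
open import Data.List.Relation.Unary.Linked using (Linked; []; [-]; _∷_)
open import Data.List.Relation.Unary.Unique.Propositional using (Unique)
import Data.List.Relation.Unary.Unique.Propositional.Properties as Unique
open import Data.Nat using (ℕ; zero; suc; _+_; _*_; _∸_; _^_; _≤_; _<_; _/_; _%_; z≤n; s≤s; _≤?_; _<?_; _<ᵇ_; _≤ᵇ_; NonZero; >-nonZero) renaming (_≟_ to _≟ℕ_)
open import Data.Nat.Combinatorics using (_C_; nCk+nC[k+1]≡[n+1]C[k+1]; nC1≡n)
open import Data.Nat.DivMod using (m≡m%n+[m/n]*n; m%n<n; m*n/n≡m; m/n*n≤m; /-monoˡ-≤; m≥n⇒m/n>0; m<n*o⇒m/o<n; m/n≡1+[m∸n]/n)
open import Data.Nat.ListAction using (sum; product)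
open import Data.Nat.ListAction.Properties using (sum-↭)
open import Data.Nat.Properties hiding (_≟_)
open import Data.Nat.Tactic.RingSolver using (solve-∀)
open import Data.Product using (Σ; ∃; _×_; _,_; proj₁; proj₂)
open import Data.Sum using (_⊎_; inj₁; inj₂)
open import Data.Empty using (⊥-elim)
open import Data.Unit using (tt)
open import Data.Vec as Vec using ([]; _∷_)
import Data.Vec.Properties as Vec
import Data.Vec.Functional as VF
open import Function using (_∘_; id)
open import Function.Definitions using (Injective)
open import Relation.Binary.Definitions using (DecidableEquality; tri<; tri≈; tri>)
open import Relation.Binary.PropositionalEquality using (_≡_; _≢_; refl; cong; cong₂; subst; subst₂; sym; module ≡-Reasoning) renaming (trans to ≡-trans)
open import Relation.Nullary using (¬_; Dec; yes; no; does; contradiction)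
open import Relation.Nullary.Decidable using (¬?; _×-dec_; decidable-stable)

-- `LocalBound` speaks only of sets with exactly `s` elements. Smaller sets may be denser than any
-- `s`-set suggests, for instance a pair of weight 2 or a triangle that forms a component of its
-- own, and an induction that deletes vertices must never leave fewer than `s` of them. Both facts
-- shape the proof. The fraction (s-2)/(s-1) comes from tree components with at most s-1 vertices,
-- and a separate estimate is needed when deleting one would leave too little. For t = s - 1 the
-- excess may legally contain short cycles and double weights, so it is not shown to have high girth
-- but exchanged for another graph on the same vertices with at least as many edges.
--
-- Trees and cycles are expressed by counting: fewer edges than vertices, or at least as many. A
-- weight above 1 then behaves like a cycle of length two, and weighted and simple graphs are
-- treated alike. Genuine cycles occur only in the translation to `NoShortCycles`.
--
-- Asymptotic bounds stay within the natural numbers: an exponent that would be a fraction with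
-- denominator b becomes a bound on m ^ b.

-- The shape in which linear consequences of l ≤ r are checked by the ring solver.
linear : ∀ {l r c d} k → l ≤ r → d + l ≡ c + r + k → c ≤ d
linear {l} {r} {c} {d} k l≤r eq = +-cancelʳ-≤ l c d
  (≤-trans (+-monoʳ-≤ c l≤r) (≤-trans (m≤m+n (c + r) k) (≤-reflexive (sym eq))))

-- Weighted edge counts over duplicate-free lists.

module _ {A : Set} where

  deg : (A → A → ℕ) → A → List A → ℕ
  deg f x ys = sum (map (f x) ys)

  e : (A → A → ℕ) → List A → ℕ
  e f []       = 0
  e f (x ∷ xs) = deg f x xs + e f xs

  cross : (A → A → ℕ) → List A → List A → ℕ
  cross f xs ys = sum (map (λ x → deg f x ys) xs)

  Symm : (A → A → ℕ) → Set
  Symm f = ∀ x y → f x y ≡ f y x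

  Irrefl : (A → A → ℕ) → Set
  Irrefl f = ∀ x → f x x ≡ 0

  _⊑_ : List A → List A → Set
  X ⊑ V = ∀ {x} → x ∈ X → x ∈ V

  LocalBound : (A → A → ℕ) → ℕ → ℕ → List A → Set
  LocalBound f s t V = ∀ X → Unique X → X ⊑ V → length X ≡ s → e f X ≤ t

  -- For `Z` inside `V` this is a union of connected components of the support of `f` on `V`.
  Closed : (A → A → ℕ) → List A → List A → Set
  Closed f Z V = ∀ {z v} → z ∈ Z → v ∈ V → v ∉ Z → f z v ≡ 0

  sum-map-cong : ∀ {g h : A → ℕ} xs → (∀ {x} → x ∈ xs → g x ≡ h x) → sum (map g xs) ≡ sum (map h xs)
  sum-map-cong []       eq = refl
  sum-map-cong (x ∷ xs) eq = cong₂ _+_ (eq (here refl)) (sum-map-cong xs (eq ∘ there))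

  sum-map-mono : ∀ {g h : A → ℕ} xs → (∀ {x} → x ∈ xs → g x ≤ h x) → sum (map g xs) ≤ sum (map h xs)
  sum-map-mono []       le = z≤n
  sum-map-mono (x ∷ xs) le = +-mono-≤ (le (here refl)) (sum-map-mono xs (le ∘ there))

  sum-map-+ : ∀ (g h : A → ℕ) xs → sum (map (λ x → g x + h x) xs) ≡ sum (map g xs) + sum (map h xs)
  sum-map-+ g h []       = refl
  sum-map-+ g h (x ∷ xs) = ≡-trans (cong (g x + h x +_) (sum-map-+ g h xs)) (interchange (g x) (h x) _ _)
    where
    interchange : ∀ a b c d → a + b + (c + d) ≡ a + c + (b + d)
    interchange = solve-∀

  sum-map-* : ∀ k (g : A → ℕ) xs → sum (map (λ x → k * g x) xs) ≡ k * sum (map g xs)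
  sum-map-* k g []       = sym (*-zeroʳ k)
  sum-map-* k g (x ∷ xs) = ≡-trans (cong (k * g x +_) (sum-map-* k g xs)) (sym (*-distribˡ-+ k (g x) _))

  sum-map-const : ∀ k (xs : List A) → sum (map (λ _ → k) xs) ≡ length xs * k
  sum-map-const k []       = refl
  sum-map-const k (x ∷ xs) = cong (k +_) (sum-map-const k xs)

  sum-map-≤ : ∀ {g : A → ℕ} k xs → (∀ {x} → x ∈ xs → g x ≤ k) → sum (map g xs) ≤ length xs * k
  sum-map-≤ k xs le = ≤-trans (sum-map-mono xs le) (≤-reflexive (sum-map-const k xs))

  sum-map-≥ : ∀ {g : A → ℕ} k xs → (∀ {x} → x ∈ xs → k ≤ g x) → length xs * k ≤ sum (map g xs)
  sum-map-≥ k xs le = ≤-trans (≤-reflexive (sym (sum-map-const k xs))) (sum-map-mono xs le)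

  sum-map-zero : ∀ {g : A → ℕ} xs → (∀ {x} → x ∈ xs → g x ≡ 0) → sum (map g xs) ≡ 0
  sum-map-zero xs eq = ≡-trans (sum-map-cong xs eq) (≡-trans (sum-map-const 0 xs) (*-zeroʳ (length xs)))

  sum-map-++ : ∀ (g : A → ℕ) xs ys → sum (map g (xs ++ ys)) ≡ sum (map g xs) + sum (map g ys)
  sum-map-++ g []       ys = refl
  sum-map-++ g (x ∷ xs) ys = ≡-trans (cong (g x +_) (sum-map-++ g xs ys)) (sym (+-assoc (g x) _ _))

  sum-map-∈ : ∀ (g : A → ℕ) {x xs} → x ∈ xs → g x ≤ sum (map g xs)
  sum-map-∈ g {xs = y ∷ xs} (here refl) = m≤m+n (g y) _
  sum-map-∈ g {xs = y ∷ xs} (there p)   = ≤-trans (sum-map-∈ g p) (m≤n+m _ (g y))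

  sum-map-≤1 : ∀ {g : A → ℕ} ys → Unique ys → (∀ {y} → y ∈ ys → g y ≤ 1) →
    (∀ {y z} → y ∈ ys → z ∈ ys → 1 ≤ g y → 1 ≤ g z → y ≡ z) → sum (map g ys) ≤ 1
  sum-map-≤1 []       _        g≤1 same = z≤n
  sum-map-≤1 {g} (y ∷ ys) (y∉ ∷ u) g≤1 same with g y in eq
  ... | zero  = sum-map-≤1 ys u (g≤1 ∘ there) (λ p q → same (there p) (there q))
  ... | suc k = +-mono-≤ {suc k} {1} (≤-trans (≤-reflexive (sym eq)) (g≤1 (here refl)))
                  (≤-reflexive (sum-map-zero ys none))
    where
    none : ∀ {z} → z ∈ ys → g z ≡ 0
    none {z} z∈ with g z in eqz
    ... | zero  = refl
    ... | suc _ = contradiction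
            (same (here refl) (there z∈) (subst (1 ≤_) (sym eq) (s≤s z≤n)) (subst (1 ≤_) (sym eqz) (s≤s z≤n)))
            (All.lookup y∉ z∈)

  e-cong : ∀ {f g : A → A → ℕ} xs → (∀ {x y} → x ∈ xs → y ∈ xs → f x y ≡ g x y) → e f xs ≡ e g xs
  e-cong []       eq = refl
  e-cong (x ∷ xs) eq = cong₂ _+_ (sum-map-cong xs (λ y∈ → eq (here refl) (there y∈)))
                                 (e-cong xs (λ p q → eq (there p) (there q)))

  e-+ : ∀ (f g : A → A → ℕ) xs → e (λ x y → f x y + g x y) xs ≡ e f xs + e g xs
  e-+ f g []       = refl
  e-+ f g (x ∷ xs) = ≡-trans (cong₂ _+_ (sum-map-+ (f x) (g x) xs) (e-+ f g xs))
                             (interchange (deg f x xs) (deg g x xs) (e f xs) (e g xs))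
    where
    interchange : ∀ a b c d → a + b + (c + d) ≡ a + c + (b + d)
    interchange = solve-∀

  e-mono : ∀ {f g : A → A → ℕ} xs → (∀ x y → f x y ≤ g x y) → e f xs ≤ e g xs
  e-mono []       le = z≤n
  e-mono (x ∷ xs) le = +-mono-≤ (sum-map-mono xs (λ {y} _ → le x y)) (e-mono xs le)

  e-zero : ∀ {f : A → A → ℕ} xs → (∀ x y → f x y ≡ 0) → e f xs ≡ 0
  e-zero []       eq = refl
  e-zero (x ∷ xs) eq = cong₂ _+_ (sum-map-zero xs (λ {y} _ → eq x y)) (e-zero xs eq)

  e-one : ∀ (xs : List A) → e (λ _ _ → 1) xs ≡ length xs C 2
  e-one []       = refl
  e-one (x ∷ xs) = ≡-trans (cong₂ _+_ (≡-trans (sum-map-const 1 xs)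
      (≡-trans (*-identityʳ _) (sym (nC1≡n (length xs))))) (e-one xs))
                           (nCk+nC[k+1]≡[n+1]C[k+1] (length xs) 1)

  module _ (f : A → A → ℕ) where

    e-++ : ∀ xs ys → e f (xs ++ ys) ≡ e f xs + e f ys + cross f xs ys
    e-++ []       ys = sym (+-identityʳ _)
    e-++ (x ∷ xs) ys = ≡-trans (cong₂ _+_ (sum-map-++ (f x) xs ys) (e-++ xs ys))
                               (rearrange (deg f x xs) (deg f x ys) (e f xs) (e f ys) (cross f xs ys))
      where
      rearrange : ∀ a b c d k → a + b + (c + d + k) ≡ a + c + d + (b + k)
      rearrange = solve-∀

    e-++-≥ : ∀ xs ys → e f xs + e f ys ≤ e f (xs ++ ys)
    e-++-≥ xs ys = ≤-trans (m≤m+n _ (cross f xs ys)) (≤-reflexive (sym (e-++ xs ys)))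

    deg-↭ : ∀ x {xs ys} → xs ↭ ys → deg f x xs ≡ deg f x ys
    deg-↭ x p = sum-↭ (map⁺ (f x) p)

    module _ (f-sym : Symm f) where

      e-↭ : ∀ {xs ys} → xs ↭ ys → e f xs ≡ e f ys
      e-↭ refl          = refl
      e-↭ (prep x p)    = cong₂ _+_ (deg-↭ x p) (e-↭ p)
      e-↭ {x ∷ y ∷ xs} {_ ∷ _ ∷ ys} (swap x y p) =
        ≡-trans (cong₂ _+_ (cong₂ _+_ (f-sym x y) (deg-↭ x p)) (cong₂ _+_ (deg-↭ y p) (e-↭ p)))
                (rearrange (f y x) (deg f x ys) (deg f y ys) (e f ys))
        where
        rearrange : ∀ a b c d → a + b + (c + d) ≡ a + c + (b + d)
        rearrange = solve-∀
      e-↭ (trans p q)   = ≡-trans (e-↭ p) (e-↭ q)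

      cross-∷ʳ : ∀ xs y ys → cross f xs (y ∷ ys) ≡ deg f y xs + cross f xs ys
      cross-∷ʳ xs y ys = ≡-trans (sum-map-+ (λ x → f x y) (λ x → deg f x ys) xs)
                                 (cong (_+ cross f xs ys) (sum-map-cong xs (λ {x} _ → f-sym x y)))

      cross-sym : ∀ xs ys → cross f xs ys ≡ cross f ys xs
      cross-sym xs []       = sum-map-zero xs (λ _ → refl)
      cross-sym xs (y ∷ ys) = ≡-trans (cross-∷ʳ xs y ys) (cong (deg f y xs +_) (cross-sym xs ys))

      handshake : Irrefl f → ∀ xs → sum (map (λ x → deg f x xs) xs) ≡ 2 * e f xs
      handshake irr []       = refl
      handshake irr (x ∷ xs) = begin
        f x x + deg f x xs + cross f xs (x ∷ xs)
          ≡⟨ cong₂ (λ a b → a + deg f x xs + b) (irr x) (cross-∷ʳ xs x xs) ⟩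
        deg f x xs + (deg f x xs + cross f xs xs)
          ≡⟨ cong (λ k → deg f x xs + (deg f x xs + k)) (handshake irr xs) ⟩
        deg f x xs + (deg f x xs + 2 * e f xs)
          ≡⟨ rearrange (deg f x xs) (e f xs) ⟩
        2 * (deg f x xs + e f xs) ∎
        where
        open ≡-Reasoning
        rearrange : ∀ a b → a + (a + 2 * b) ≡ 2 * (a + b)
        rearrange = solve-∀

  ∈⇒↭ : ∀ {x} {xs : List A} → x ∈ xs → ∃ λ ys → xs ↭ x ∷ ys
  ∈⇒↭ p with ∈-∃++ p
  ... | ys , zs , refl = ys ++ zs , shift _ ys zs

  Unique-resp-↭ : ∀ {xs ys : List A} → xs ↭ ys → Unique xs → Unique ys
  Unique-resp-↭ refl        u                       = u
  Unique-resp-↭ (prep x p)  (x∉ ∷ u)                = All-resp-↭ p x∉ ∷ Unique-resp-↭ p u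
  Unique-resp-↭ (swap x y p) ((x≢y ∷ x∉) ∷ (y∉ ∷ u)) =
    ((λ y≡x → x≢y (sym y≡x)) ∷ All-resp-↭ p y∉) ∷ (All-resp-↭ p x∉ ∷ Unique-resp-↭ p u)
  Unique-resp-↭ (trans p q) u                       = Unique-resp-↭ q (Unique-resp-↭ p u)

  ∉⇒All≢ : ∀ {x : A} {xs} → x ∉ xs → All (x ≢_) xs
  ∉⇒All≢ {xs = []}     _  = []
  ∉⇒All≢ {xs = y ∷ xs} x∉ = (λ x≡y → x∉ (here x≡y)) ∷ ∉⇒All≢ (x∉ ∘ there)

  All≢⇒∉ : ∀ {x : A} {xs} → All (x ≢_) xs → x ∉ xs
  All≢⇒∉ x≢ x∈ = All.lookup x≢ x∈ refl

  -- `R` is the complement of `X`. Obtaining it from a permutation avoids deciding equality on `A`.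
  ⊑⇒↭ : ∀ X {V : List A} → Unique X → X ⊑ V → ∃ λ R → V ↭ X ++ R
  ⊑⇒↭ []       {V} _ _ = V , ↭-refl
  ⊑⇒↭ (x ∷ X) {V} (x∉ ∷ u) X⊑ with ∈⇒↭ (X⊑ (here refl))
  ... | V′ , p with ⊑⇒↭ X u X⊑V′
    where
    X⊑V′ : X ⊑ V′
    X⊑V′ y∈ with ∈-resp-↭ p (X⊑ (there y∈))
    ... | here refl = contradiction y∈ (All≢⇒∉ x∉)
    ... | there q   = q
  ...   | R , q = R , ↭-trans p (prep x q)

  ⊑⇒length≤ : ∀ {X V : List A} → Unique X → X ⊑ V → length X ≤ length V
  ⊑⇒length≤ {X} {V} u X⊑ with ⊑⇒↭ X u X⊑
  ... | R , p = ≤-trans (m≤m+n (length X) (length R))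
                  (≤-reflexive (≡-trans (sym (length-++ X)) (sym (↭-length p))))

  ⊑-length≡⇒↭ : ∀ {X V : List A} → Unique X → X ⊑ V → length V ≤ length X → X ↭ V
  ⊑-length≡⇒↭ {X} {V} u X⊑ le with ⊑⇒↭ X u X⊑
  ... | []    , p = ↭-sym (↭-trans p (++-comm X []))
  ... | y ∷ R , p = contradiction le (<⇒≱ (subst (suc (length X) ≤_) (sym len)
                      (subst (_≤ length X + suc (length R)) (+-comm (length X) 1) (+-monoʳ-≤ (length X) (s≤s z≤n)))))
    where
    len : length V ≡ length X + suc (length R)
    len = ≡-trans (↭-length p) (length-++ X)

  ⊑⊒⇒↭ : ∀ {X V : List A} → Unique X → Unique V → X ⊑ V → V ⊑ X → X ↭ V
  ⊑⊒⇒↭ uX uV X⊑V V⊑X = ⊑-length≡⇒↭ uX X⊑V (⊑⇒length≤ uV V⊑X)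

  Unique-++⁻ : ∀ (X : List A) {R} → Unique (X ++ R) → Unique X × Unique R × (∀ {z} → z ∈ X → z ∉ R)
  Unique-++⁻ []      u        = [] , u , λ ()
  Unique-++⁻ (x ∷ X) {R} (x∉ ∷ u) with Unique-++⁻ X u
  ... | uX , uR , dis = All.++⁻ˡ X x∉ ∷ uX , uR , dis′
    where
    dis′ : ∀ {z} → z ∈ x ∷ X → z ∉ R
    dis′ (here refl) = All≢⇒∉ (All.++⁻ʳ X x∉)
    dis′ (there p)   = dis p

  Unique-++⁺ : ∀ {X R : List A} → Unique X → Unique R → (∀ {z} → z ∈ X → z ∉ R) → Unique (X ++ R)
  Unique-++⁺ uX uR dis = Unique.++⁺ uX uR (λ (p , q) → dis p q)

-- The constructive form of looking at a vertex of minimum degree: either some vertex can be deleted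
-- cheaply, or the handshake lemma applies with all degrees large.
small-or-large : ∀ {A : Set} (g : A → ℕ) k xs →
  (∃ λ x → x ∈ xs × g x ≤ k) ⊎ (∀ {x} → x ∈ xs → suc k ≤ g x)
small-or-large g k xs with any? (λ x → g x ≤? k) xs
... | yes p = inj₁ (find p)
... | no ¬p = inj₂ (λ x∈ → ≰⇒> (λ le → ¬p (lose x∈ le)))

-- Deleting vertices and exploring components under a local bound.

module Components {A : Set} (_≟_ : DecidableEquality A) (f : A → A → ℕ) (f-sym : Symm f) (f-irr : Irrefl f) where

  open import Data.List.Membership.DecPropositional _≟_ using (_∈?_)

  record Removal (v : A) (V : List A) : Set where
    field
      rest   : List A
      perm   : V ↭ v ∷ rest
      unique : Unique rest
      sub    : rest ⊑ V
      size   : length V ≡ suc (length rest)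
      -- The degree is taken in all of `V`, to match degree hypotheses on `V`; this is harmless
      -- because `f v v` is zero.
      e-eq   : e f V ≡ deg f v V + e f rest

  remove : ∀ {v V} → Unique V → v ∈ V → Removal v V
  remove {v} {V} u v∈ with ∈⇒↭ v∈
  ... | R , p = record
    { rest   = R
    ; perm   = p
    ; unique = tail-unique (Unique-resp-↭ p u)
    ; sub    = λ x∈ → ∈-resp-↭ (↭-sym p) (there x∈)
    ; size   = ↭-length p
    ; e-eq   = ≡-trans (e-↭ f f-sym p) (cong (_+ e f R) (sym deg-eq))
    }
    where
    tail-unique : ∀ {x xs} → Unique {A = A} (x ∷ xs) → Unique xs
    tail-unique (_ ∷ w) = w
    deg-eq : deg f v V ≡ deg f v R
    deg-eq = ≡-trans (deg-↭ f v p) (cong (_+ deg f v R) (f-irr v))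

  LocalBound-⊑ : ∀ {s t V W} → W ⊑ V → LocalBound f s t V → LocalBound f s t W
  LocalBound-⊑ W⊑ sp X u X⊑ = sp X u (W⊑ ∘ X⊑)

  -- If e(V) = t + 1 + j, then by induction every vertex has degree at least j + 1,
  -- and the handshake lemma bounds |V| by 2t + 2.
  few-edges : ∀ r s t V → 2 * t + 2 ≤ s → Unique V → length V ≡ s + r → LocalBound f s t V → e f V ≤ t
  few-edges zero    s t V t≤s u len sp = sp V u id (≡-trans len (+-identityʳ s))
  few-edges (suc r) s t V t≤s u len sp with e f V ≤? t
  ... | yes le = le
  ... | no  nle with m≤n⇒∃[o]m+o≡n (≰⇒> nle)
  ...   | j , eq with small-or-large (λ x → deg f x V) j V
  ...     | inj₁ (x , x∈ , d≤j) = contradiction (≤-trans (≤-reflexive e-eq) (+-mono-≤ d≤j IH))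
        (<⇒≱ (≤-reflexive (≡-trans (cong suc (+-comm j t)) eq)))
    where
    open Removal (remove u x∈)
    IH : e f rest ≤ t
    IH = few-edges r s t rest t≤s unique (suc-injective (≡-trans (sym size) (≡-trans len (+-suc s r))))
        (LocalBound-⊑ sub sp)
  ...     | inj₂ large = ⊥-elim (1+n≰n {0} (linear 0 bound (arith t j)))
    where
    big : 2 * t + 3 ≤ length V
    big = ≤-trans (≤-reflexive (≡-trans (+-suc (2 * t) 2) refl)) (≤-trans (s≤s (≤-trans t≤s (m≤m+n s r)))
            (≤-reflexive (≡-trans (sym (+-suc s r)) (sym len))))
    bound : (2 * t + 3) * suc j + 0 ≤ 2 * (suc t + j) + (2 * t * j + j)
    bound = +-mono-≤ (≤-trans (*-monoˡ-≤ (suc j) big) (≤-trans (sum-map-≥ (suc j) V large)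
              (≤-reflexive (≡-trans (handshake f f-sym f-irr V) (cong (2 *_) (sym eq)))))) z≤n
    arith : ∀ t j → 0 + ((2 * t + 3) * suc j + 0) ≡ 1 + (2 * (suc t + j) + (2 * t * j + j)) + 0
    arith = solve-∀

  -- `gain` says, without subtraction, that edges minus vertices does not drop from `Z` to `set`.
  record Growth (V Z : List A) (m : ℕ) : Set where
    field
      set    : List A
      unique : Unique set
      sub    : set ⊑ V
      sup    : Z ⊑ set
      gain   : e f Z + length set ≤ e f set + length Z
      stop   : length set ≡ m ⊎ (length set < m × Closed f set V)

  -- Greedy: an outside vertex with positive degree into the current set is absorbed and pays for
  -- itself with an edge. When no such vertex exists, the set is closed.
  grow : ∀ gas V Z m → Unique Z → Z ⊑ V → length Z ≤ m → m ≤ length Z + gas → Growth V Z m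
  grow zero    V Z m u Z⊑ Z≤m m≤ = record
    { set = Z ; unique = u ; sub = Z⊑ ; sup = id ; gain = ≤-refl
    ; stop = inj₁ (≤-antisym Z≤m (≤-trans m≤ (≤-reflexive (+-identityʳ _)))) }
  grow (suc gas) V Z m u Z⊑ Z≤m m≤ with length Z <? m
  ... | no  Z≮m = record
    { set = Z ; unique = u ; sub = Z⊑ ; sup = id ; gain = ≤-refl
    ; stop = inj₁ (≤-antisym Z≤m (≮⇒≥ Z≮m)) }
  ... | yes Z<m with any? (λ v → ¬? (v ∈? Z) ×-dec (1 ≤? deg f v Z)) V
  ...   | no ¬p = record
    { set = Z ; unique = u ; sub = Z⊑ ; sup = id ; gain = ≤-refl
    ; stop = inj₂ (Z<m , λ {z} {v} z∈ v∈ v∉ → ≡-trans (f-sym z v)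
        (n≤0⇒n≡0 (≤-trans (sum-map-∈ (f v) z∈) (≤-pred (≰⇒> (λ 1≤ → ¬p (lose v∈ (v∉ , 1≤)))))))) }
  ...   | yes p with find p
  ...     | v , v∈ , v∉ , 1≤deg = record
    { set = set ; unique = unique ; sub = sub ; sup = sup ∘ there
    ; gain = ≤-pred (≤-trans (+-monoˡ-≤ (e f Z + length set) 1≤deg)
               (≤-trans (≤-reflexive (sym (+-assoc (deg f v Z) _ _)))
               (≤-trans gain (≤-reflexive (+-suc (e f set) (length Z))))))
    ; stop = stop }
    where
    vZ⊑ : (v ∷ Z) ⊑ V
    vZ⊑ (here refl) = v∈
    vZ⊑ (there q)   = Z⊑ q
    open Growth (grow gas V (v ∷ Z) m (∉⇒All≢ v∉ ∷ u) vZ⊑ Z<m (≤-trans m≤ (≤-reflexive (+-suc (length Z) gas))))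

  -- The tree is recorded by its edge count, which is what yields a vertex of degree at most 1.
  record ClosedTree (V : List A) (s : ℕ) : Set where
    field
      tree   : List A
      unique : Unique tree
      sub    : tree ⊑ V
      closed : Closed f tree V
      size   : length tree < s
      sparse : e f tree < length tree

  -- The successor in `dense` grants one vertex outside `Y` that brought no edge: the first vertex
  -- of the component in which the exploration broke off.
  record DenseSet (V Y : List A) (s : ℕ) : Set where
    field
      set    : List A
      unique : Unique set
      sub    : set ⊑ V
      size   : length set ≡ s
      dense  : e f Y + s ≤ e f set + suc (length Y)

  -- Exhaust V component by component, starting from Y.  As long as no component is a tree, each
  -- vertex added brings one more edge, except possibly the first vertex of the last component.
  closedTree-or-dense : ∀ gas {V} s Y → Unique V → Unique Y → Y ⊑ V → Closed f Y V → length Y ≤ s →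
    s ≤ length Y + gas → s ≤ length V → ClosedTree V s ⊎ DenseSet V Y s
  closedTree-or-dense gas {V} s Y uV u Y⊑ clY Y≤s s≤ s≤V with length Y <? s
  ... | no Y≮s = inj₂ (record
    { set = Y ; unique = u ; sub = Y⊑ ; size = ≤-antisym Y≤s (≮⇒≥ Y≮s)
    ; dense = +-monoʳ-≤ (e f Y) (≤-trans (≮⇒≥ Y≮s) (n≤1+n _)) })
  closedTree-or-dense zero s Y uV u Y⊑ clY Y≤s s≤ s≤V | yes Y<s =
    contradiction (≤-trans s≤ (≤-reflexive (+-identityʳ _))) (<⇒≱ Y<s)
  closedTree-or-dense (suc gas) {V} s Y uV u Y⊑ clY Y≤s s≤ s≤V | yes Y<s with any? (λ v → ¬? (v ∈? Y)) V
  ... | no none = contradiction (≤-trans Y<s s≤V) (≤⇒≯ (⊑⇒length≤ uV covered))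
    where
    covered : V ⊑ Y
    covered {x} x∈ with x ∈? Y
    ... | yes p = p
    ... | no ¬p = contradiction (lose x∈ ¬p) none
  ... | yes p with find p
  ...   | v , v∈ , v∉ = finish (⊑⇒↭ Y u (Growth.sup g ∘ there)) (Growth.stop g)
    where
    vY⊑ : (v ∷ Y) ⊑ V
    vY⊑ (here refl) = v∈
    vY⊑ (there q)   = Y⊑ q
    g : Growth V (v ∷ Y) s
    g = grow s V (v ∷ Y) s (∉⇒All≢ v∉ ∷ u) vY⊑ Y<s (m≤n+m s (suc (length Y)))
    open Growth g using (set; unique; sub; sup; gain)

    gain′ : e f Y + length set ≤ e f set + suc (length Y)
    gain′ = ≤-trans (+-monoˡ-≤ (length set) (m≤n+m (e f Y) (deg f v Y))) gain

    finish : (∃ λ K → set ↭ Y ++ K) → length set ≡ s ⊎ (length set < s × Closed f set V) →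
             ClosedTree V s ⊎ DenseSet V Y s
    finish (K , q) (inj₁ len) = inj₂ (record
      { set = set ; unique = unique ; sub = sub ; size = len
      ; dense = subst (λ k → e f Y + k ≤ e f set + suc (length Y)) len gain′ })
    finish (K , q) (inj₂ (set<s , cl)) with e f K <? length K | Unique-++⁻ Y (Unique-resp-↭ q unique)
    ... | yes eK<K | _ , uK , dis = inj₁ (record
      { tree = K ; unique = uK ; sub = sub ∘ K⊑set ; closed = clK
      ; size = ≤-<-trans (⊑⇒length≤ uK K⊑set) set<s ; sparse = eK<K })
      where
      K⊑set : K ⊑ set
      K⊑set x∈ = ∈-resp-↭ (↭-sym q) (∈-++⁺ʳ Y x∈)
      clK : Closed f K V
      clK {z} {x} z∈ x∈ x∉ with x ∈? Y
      ... | yes x∈Y = ≡-trans (f-sym z x) (clY x∈Y (sub (K⊑set z∈)) (λ z∈Y → dis z∈Y z∈))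
      ... | no  x∉Y = cl (K⊑set z∈) x∈ x∉set
        where
        x∉set : x ∉ set
        x∉set x∈set with ∈-++⁻ Y (∈-resp-↭ q x∈set)
        ... | inj₁ x∈Y = x∉Y x∈Y
        ... | inj₂ x∈K = x∉ x∈K
    -- The completed component `K` has at least as many edges as vertices, which repays the edge
    -- missing at its first vertex. The recursion thus restarts from `set` without debt.
    ... | no  eK≮K | _ , uK , dis with closedTree-or-dense gas s set uV unique sub cl (<⇒≤ set<s)
                    (≤-trans s≤ (≤-trans (≤-reflexive (+-suc (length Y) gas))
                      (+-monoˡ-≤ gas (⊑⇒length≤ (∉⇒All≢ v∉ ∷ u) sup)))) s≤V
    ...   | inj₁ tree = inj₁ tree
    ...   | inj₂ X = inj₂ (record
      { set = DenseSet.set X ; unique = DenseSet.unique X ; sub = DenseSet.sub X ; size = DenseSet.size X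
      ; dense = linear 0 (+-mono-≤ (DenseSet.dense X) (+-mono-≤ e-set (≤-reflexive len)))
                  (arith (e f Y) s (e f (DenseSet.set X)) (length Y) (e f set) (length set) (length K)) })
      where
      len : length set ≡ length Y + length K
      len = ≡-trans (↭-length q) (length-++ Y)
      e-set : e f Y + length K ≤ e f set
      e-set = ≤-trans (+-monoʳ-≤ (e f Y) (≮⇒≥ eK≮K)) (≤-trans (e-++-≥ f Y K) (≤-reflexive (sym (e-↭ f f-sym q))))
      arith : ∀ a s b y c d k →
        (b + suc y) + (c + s + (a + k + d)) ≡ (a + s) + (b + suc d + (c + (y + k))) + 0
      arith = solve-∀

  Closed⇒cross≡0 : ∀ {V T R} → Unique V → Closed f T V → V ↭ T ++ R → cross f T R ≡ 0
  Closed⇒cross≡0 {V} {T} {R} uV cl p = sum-map-zero T (λ z∈ → sum-map-zero R (λ r∈ →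
    cl z∈ (∈-resp-↭ (↭-sym p) (∈-++⁺ʳ T r∈)) (λ r∈T → proj₂ (proj₂ (Unique-++⁻ T (Unique-resp-↭ p uV))) r∈T r∈)))

  Closed⇒deg≡ : ∀ {V T} → Unique V → Unique T → T ⊑ V → Closed f T V → ∀ {v} → v ∈ T → deg f v V ≡ deg f v T
  Closed⇒deg≡ {V} {T} uV uT T⊑ cl {v} v∈ with ⊑⇒↭ T uT T⊑
  ... | R , p = ≡-trans (deg-↭ f v p) (≡-trans (sum-map-++ (f v) T R)
                  (≡-trans (cong (deg f v T +_) (sum-map-zero R none)) (+-identityʳ _)))
    where
    none : ∀ {r} → r ∈ R → f v r ≡ 0
    none r∈ = cl v∈ (∈-resp-↭ (↭-sym p) (∈-++⁺ʳ T r∈))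
                (λ r∈T → proj₂ (proj₂ (Unique-++⁻ T (Unique-resp-↭ p uV))) r∈T r∈)

  -- If all degrees were at least 2, the handshake lemma would give at least as many edges as
  -- vertices.
  sparse⇒leaf : ∀ T → e f T < length T → ∃ λ v → v ∈ T × deg f v T ≤ 1
  sparse⇒leaf T sparse with small-or-large (λ x → deg f x T) 1 T
  ... | inj₁ leaf  = leaf
  ... | inj₂ large = contradiction
    (*-cancelˡ-≤ 2 (≤-trans (≤-reflexive (*-comm 2 (length T)))
      (≤-trans (sum-map-≥ 2 T large) (≤-reflexive (handshake f f-sym f-irr T)))))
    (<⇒≱ sparse)

  module _ (t : ℕ) where

    -- Exploring from the empty set, the alternative is an `s`-set with at least `s − 1` edges, one
    -- more than `t = s − 2` allows.
    closedTree : ∀ V → Unique V → 2 + t ≤ length V → LocalBound f (2 + t) t V → ClosedTree V (2 + t)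
    closedTree V u le sp with closedTree-or-dense (2 + t) (2 + t) [] u [] (λ ()) (λ ()) z≤n ≤-refl le
    ... | inj₁ T = T
    ... | inj₂ X = contradiction (sp set unique sub size)
                     (<⇒≱ (≤-pred (≤-trans dense (≤-reflexive (+-comm (e f set) 1)))))
      where open DenseSet X

    -- Leaves of tree components are deleted, each costing at most one edge, until an `s`-set is
    -- left; for that set the deficit 2 is the local bound itself.
    e+2≤length : ∀ r V → Unique V → length V ≡ 2 + t + r → LocalBound f (2 + t) t V → e f V + 2 ≤ length V
    e+2≤length zero V u len sp = ≤-trans (+-monoˡ-≤ 2 (sp V u id len′)) (≤-reflexive (≡-trans (+-comm t 2) (sym len′)))
      where
      len′ : length V ≡ 2 + t
      len′ = ≡-trans len (+-identityʳ _)
    e+2≤length (suc r) V u len sp = bound (sparse⇒leaf tree sparse)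
      where
      open ClosedTree (closedTree V u (≤-trans (m≤m+n _ (suc r)) (≤-reflexive (sym len))) sp)
      bound : (∃ λ v → v ∈ tree × deg f v tree ≤ 1) → e f V + 2 ≤ length V
      bound (v , v∈ , leaf) = ≤-trans (+-monoˡ-≤ 2 (≤-reflexive (Removal.e-eq rm)))
          (≤-trans (≤-reflexive (+-assoc (deg f v V) _ 2))
          (≤-trans (+-mono-≤ (≤-trans (≤-reflexive (Closed⇒deg≡ u unique sub closed v∈)) leaf) IH)
                   (≤-reflexive (sym (Removal.size rm)))))
        where
        rm : Removal v V
        rm = remove u (sub v∈)
        IH : e f (Removal.rest rm) + 2 ≤ length (Removal.rest rm)
        IH = e+2≤length r (Removal.rest rm) (Removal.unique rm)
               (suc-injective (≡-trans (sym (Removal.size rm)) (≡-trans len (+-suc (2 + t) r))))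
               (LocalBound-⊑ (Removal.sub rm) sp)

    -- A tree component with `k ≤ t + 1` vertices has at most `k − 1` edges, and
    -- `(t + 1) * (k − 1) ≤ t * k`, so it can be split off.
    forest-bound : ∀ gas V → length V ≤ gas → Unique V → 2 + t ≤ length V → LocalBound f (2 + t) t V →
      suc t * e f V ≤ t * length V
    forest-bound zero V V≤ u le sp = contradiction (≤-trans le V≤) λ ()
    -- The threshold serves both cases. Up to `2 * t + 2` vertices, `e+2≤length` implies the claim;
    -- beyond it, deleting at most `t + 1` vertices leaves the `t + 2` that the induction needs.
    forest-bound (suc gas) V V≤ u le sp with length V ≤? 2 * t + 2
    ... | yes small = linear 0 (+-mono-≤ (*-monoʳ-≤ (suc t) e+2≤) small) (arith t (e f V) (length V))
      where
      e+2≤ : e f V + 2 ≤ length V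
      e+2≤ = e+2≤length (length V ∸ (2 + t)) V u (sym (m+[n∸m]≡n le)) sp
      arith : ∀ t a n → t * n + (suc t * (a + 2) + n) ≡ suc t * a + (suc t * n + (2 * t + 2)) + 0
      arith = solve-∀
    ... | no large with ⊑⇒↭ (ClosedTree.tree tr) (ClosedTree.unique tr) (ClosedTree.sub tr)
      where
      tr : ClosedTree V (2 + t)
      tr = closedTree V u le sp
    ...   | R , p = ≤-trans (≤-reflexive (cong (suc t *_) e-split))
                      (≤-trans (linear 0 (+-mono-≤ IH (+-mono-≤ (*-monoʳ-≤ t sparse) (+-mono-≤ (≤-pred size) sparse)))
                         (arith t (e f tree) (e f R) (length tree) (length R)))
                      (≤-reflexive (cong (t *_) (sym len))))
      where
      open ClosedTree (closedTree V u le sp)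
      len : length V ≡ length tree + length R
      len = ≡-trans (↭-length p) (length-++ tree)
      e-split : e f V ≡ e f tree + e f R
      e-split = ≡-trans (e-↭ f f-sym p) (≡-trans (e-++ f tree R)
                  (≡-trans (cong (e f tree + e f R +_) (Closed⇒cross≡0 u closed p)) (+-identityʳ _)))
      large-R : 2 + t ≤ length R
      large-R = linear 0 (+-mono-≤ (≤-trans (≰⇒> large) (≤-reflexive len)) (≤-pred size))
                  (arith₂ t (length tree) (length R))
        where
        arith₂ : ∀ t k r → r + (suc (2 * t + 2) + k) ≡ 2 + t + (k + r + suc t) + 0
        arith₂ = solve-∀
      R≤ : length R ≤ gas
      R≤ = ≤-pred (≤-trans (+-monoˡ-≤ (length R) (≤-trans (s≤s z≤n) sparse)) (≤-trans (≤-reflexive (sym len)) V≤))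
      IH : suc t * e f R ≤ t * length R
      IH = forest-bound gas R R≤ (proj₁ (proj₂ (Unique-++⁻ tree (Unique-resp-↭ p u)))) large-R
             (LocalBound-⊑ (λ x∈ → ∈-resp-↭ (↭-sym p) (∈-++⁺ʳ tree x∈)) sp)
      arith : ∀ t a b k r →
        t * (k + r) + (suc t * b + (t * suc a + (k + suc a))) ≡ suc t * (a + b) + (t * r + (t * k + (suc t + k))) + 0
      arith = solve-∀

-- Graphs of high girth

indicator : ∀ {Q : Set} → Dec Q → ℕ
indicator (yes _) = 1
indicator (no _)  = 0

indicator-≤1 : ∀ {Q : Set} (d : Dec Q) → indicator d ≤ 1
indicator-≤1 (yes _) = ≤-refl
indicator-≤1 (no _)  = z≤n

indicator-true : ∀ {Q : Set} (d : Dec Q) → 1 ≤ indicator d → Q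
indicator-true (yes p) _ = p

indicator-yes : ∀ {Q : Set} (d : Dec Q) → Q → indicator d ≡ 1
indicator-yes (yes _) _ = refl
indicator-yes (no ¬p) p = contradiction p ¬p

indicator-no : ∀ {Q : Set} (d : Dec Q) → ¬ Q → indicator d ≡ 0
indicator-no (yes p) ¬p = contradiction p ¬p
indicator-no (no _)  _  = refl

any⊆? : ∀ {A : Set} {Q : List A → Set} → (∀ X → Dec (Q X)) → ∀ V → Dec (∃ λ X → X ⊆ V × Q X)
any⊆? Q? [] with Q? []
... | yes p = yes ([] , [] , p)
... | no ¬p = no λ { (_ , [] , p) → ¬p p }
any⊆? Q? (x ∷ V) with any⊆? (Q? ∘ (x ∷_)) V | any⊆? Q? V
... | yes (X , s , p) | _               = yes (x ∷ X , refl ∷ s , p)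
... | no _            | yes (X , s , p) = yes (X , x ∷ʳ s , p)
... | no ¬p           | no ¬q           = no λ { (_ , _ ∷ʳ s , p) → ¬q (_ , s , p) ; (_ , refl ∷ s , p) → ¬p
      (_ , s , p) }

Unique-⊆ : ∀ {A : Set} {X V : List A} → X ⊆ V → Unique V → Unique X
Unique-⊆ []         _        = []
Unique-⊆ (_ ∷ʳ s)   (_ ∷ u)  = Unique-⊆ s u
Unique-⊆ (refl ∷ s) (v∉ ∷ u) = All-resp-⊆ s v∉ ∷ Unique-⊆ s u

module _ {A : Set} (f : A → A → ℕ) where

  e-path : ∀ {x xs} → Linked (λ a b → 1 ≤ f a b) (x ∷ xs) → length xs ≤ e f (x ∷ xs)
  e-path [-]                          = z≤n
  e-path {x} {y ∷ xs} (1≤fxy ∷ path) = +-mono-≤ (≤-trans 1≤fxy (m≤m+n (f x y) (deg f x xs))) (e-path path)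

  -- Since `w` lies beyond `y`, the edge from `x` to `w` is not on the path, and the row of `x`
  -- counts two edges. This is one more than `e-path` gives.
  e-cycle : ∀ {x y w zs} → Linked (λ a b → 1 ≤ f a b) (x ∷ y ∷ zs) → w ∈ zs → 1 ≤ f x w →
    length (x ∷ y ∷ zs) ≤ e f (x ∷ y ∷ zs)
  e-cycle {x} (1≤fxy ∷ path) w∈ 1≤fxw = +-mono-≤ (+-mono-≤ 1≤fxy (≤-trans 1≤fxw (sum-map-∈ (f x) w∈))) (e-path path)

-- For a simple graph g this says that g has no cycle of length at most s inside V.
ShortCycleFree : ∀ {A : Set} → (A → A → ℕ) → ℕ → List A → Set
ShortCycleFree g s V = ∀ X → Unique X → X ⊑ V → 1 ≤ length X → length X ≤ s → e g X < length X

module Girth {A : Set} (_≟_ : DecidableEquality A) (s : ℕ) where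

  open import Data.List.Membership.DecPropositional _≟_ using (_∈?_)

  record Short (f : A → A → ℕ) (V : List A) : Set where
    field
      set      : List A
      unique   : Unique set
      sub      : set ⊑ V
      nonempty : 1 ≤ length set
      short    : length set ≤ s
      dense    : length set ≤ e f set

  short-or-free : ∀ {f} → Symm f → ∀ {V} → Unique V → Short f V ⊎ ShortCycleFree f s V
  short-or-free {f} f-sym {V} u
    with any⊆? (λ X → (1 ≤? length X) ×-dec (length X ≤? s) ×-dec (length X ≤? e f X)) V
  ... | yes (X , X⊆ , 1≤ , ≤s , dense) = inj₁ (record
    { set = X ; unique = Unique-⊆ X⊆ u ; sub = Any-resp-⊆ X⊆ ; nonempty = 1≤ ; short = ≤s ; dense = dense })
  ... | no none = inj₂ free
    where
    free : ShortCycleFree f s V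
    -- The search ran through sublists of `V` only, so `X` is first put into the order of `V`.
    free X uX X⊑ 1≤ ≤s = ≰⇒> λ dense → none (filter (_∈? X) V , filter-⊆ (_∈? X) V ,
        subst (1 ≤_) len 1≤ , subst (_≤ s) len ≤s , ≤-trans (≤-reflexive (sym len))
            (≤-trans dense (≤-reflexive (e-↭ f f-sym p))))
      where
      p : X ↭ filter (_∈? X) V
      p = ⊑⊒⇒↭ uX (Unique.filter⁺ (_∈? X) u) (λ x∈ → ∈-filter⁺ (_∈? X) (X⊑ x∈) x∈)
          (λ x∈ → proj₂ (∈-filter⁻ (_∈? X) {xs = V} x∈))
      len : length X ≡ length (filter (_∈? X) V)
      len = ↭-length p

  -- The graph may differ completely from the excess that it replaces. Only the number of edges is
  -- compared, and as a lower bound, so that a surplus can be forgotten.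
  record HighGirth (V : List A) (k : ℕ) : Set where
    field
      graph : A → A → ℕ
      symm  : Symm graph
      irr   : Irrefl graph
      free  : ShortCycleFree graph s V
      size  : k ≤ e graph V

  HighGirth-↭ : ∀ {V W k} → V ↭ W → HighGirth V k → HighGirth W k
  HighGirth-↭ {V} {W} p G = record
    { graph = graph ; symm = symm ; irr = irr
    ; free = λ X u X⊑ → free X u (∈-resp-↭ (↭-sym p) ∘ X⊑)
    ; size = ≤-trans size (≤-reflexive (e-↭ graph symm p)) }
    where open HighGirth G

  HighGirth-≤ : ∀ {V j k} → j ≤ k → HighGirth V k → HighGirth V j
  HighGirth-≤ j≤k G = record
    { graph = graph ; symm = symm ; irr = irr ; free = free ; size = ≤-trans j≤k size }
    where open HighGirth G

  module Pendant (g : A → A → ℕ) (v u : A) where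

    pendant : A → A → ℕ
    pendant x y with x ≟ v | y ≟ v
    ... | yes _ | yes _ = 0
    ... | yes _ | no  _ = indicator (y ≟ u)
    ... | no  _ | yes _ = indicator (x ≟ u)
    ... | no  _ | no  _ = g x y

    pendant-sym : Symm g → Symm pendant
    pendant-sym g-sym x y with x ≟ v | y ≟ v
    ... | yes _ | yes _ = refl
    ... | yes _ | no  _ = refl
    ... | no  _ | yes _ = refl
    ... | no  _ | no  _ = g-sym x y

    pendant-irr : Irrefl g → Irrefl pendant
    pendant-irr g-irr x with x ≟ v
    ... | yes _ = refl
    ... | no  _ = g-irr x

    pendant-old : ∀ {x y} → x ≢ v → y ≢ v → pendant x y ≡ g x y
    pendant-old {x} {y} x≢v y≢v with x ≟ v | y ≟ v
    ... | yes x≡v | _       = contradiction x≡v x≢v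
    ... | no  _   | yes y≡v = contradiction y≡v y≢v
    ... | no  _   | no  _   = refl

    pendant-new : ∀ {y} → y ≢ v → pendant v y ≡ indicator (y ≟ u)
    pendant-new {y} y≢v with v ≟ v | y ≟ v
    ... | no v≢v | _       = contradiction refl v≢v
    ... | yes _  | yes y≡v = contradiction y≡v y≢v
    ... | yes _  | no  _   = refl

    e-pendant-old : ∀ X → v ∉ X → e pendant X ≡ e g X
    e-pendant-old X v∉ = e-cong X (λ x∈ y∈ → pendant-old (λ { refl → v∉ x∈ }) (λ { refl → v∉ y∈ }))

    deg-pendant : ∀ X → v ∉ X → deg pendant v X ≡ sum (map (λ y → indicator (y ≟ u)) X)
    deg-pendant X v∉ = sum-map-cong X (λ y∈ → pendant-new (λ { refl → v∉ y∈ }))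

  -- `v` is joined to the head of `V` alone. A set that contains `v` thus has one vertex and at most
  -- one edge more than without it, and no new dense set arises.
  addPendant : ∀ {v V k} → v ∉ V → 1 ≤ length V → HighGirth V k → HighGirth (v ∷ V) (suc k)
  addPendant {v} {V@(u ∷ _)} {k} v∉ _ G = record
    { graph = pendant ; symm = pendant-sym symm ; irr = pendant-irr irr ; free = free′
    ; size = +-mono-≤ (≤-trans (≤-reflexive (sym (indicator-yes (u ≟ u) refl)))
               (≤-trans (sum-map-∈ (λ y → indicator (y ≟ u)) {xs = V} (here refl))
                   (≤-reflexive (sym (deg-pendant V v∉)))))
               (≤-trans size (≤-reflexive (sym (e-pendant-old V v∉)))) }
    where
    open HighGirth G
    open Pendant graph v u
    ⊑-old : ∀ {X} → X ⊑ (v ∷ V) → v ∉ X → X ⊑ V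
    ⊑-old X⊑ v∉X x∈ with X⊑ x∈
    ... | here refl = contradiction x∈ v∉X
    ... | there q   = q
    free′ : ShortCycleFree pendant s (v ∷ V)
    free′ X uX X⊑ 1≤ ≤s with v ∈? X
    ... | no v∉X = subst (_< length X) (sym (e-pendant-old X v∉X)) (free X uX (⊑-old X⊑ v∉X) 1≤ ≤s)
    ... | yes v∈X with ∈⇒↭ v∈X
    ...   | X′ , p with Unique-resp-↭ p uX
    ...     | v≢ ∷ uX′ = subst₂ _<_ (sym (e-↭ pendant (pendant-sym symm) p)) (sym (↭-length p))
          (s≤s (bound X′ v∉X′ uX′ X′⊑ X′≤s))
      where
      v∉X′ : v ∉ X′
      v∉X′ = All≢⇒∉ v≢
      X′⊑ : X′ ⊑ V
      X′⊑ = ⊑-old (λ x∈ → X⊑ (∈-resp-↭ (↭-sym p) (there x∈))) v∉X′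
      X′≤s : length X′ ≤ s
      X′≤s = ≤-trans (n≤1+n _) (≤-trans (≤-reflexive (sym (↭-length p))) ≤s)
      bound : ∀ Y → v ∉ Y → Unique Y → Y ⊑ V → length Y ≤ s → e pendant (v ∷ Y) ≤ length Y
      bound []        _   _  _  _  = z≤n
      bound Y@(_ ∷ _) v∉Y uY Y⊑ ≤s = +-mono-≤ {deg pendant v Y} {1} {e pendant Y}
        (≤-trans (≤-reflexive (deg-pendant Y v∉Y)) (sum-map-≤1 Y uY (λ {y} _ → indicator-≤1 (y ≟ u))
          (λ {y} {z} _ _ p q → ≡-trans (indicator-true (y ≟ u) p) (sym (indicator-true (z ≟ u) q)))))
        (≤-trans (≤-reflexive (e-pendant-old Y v∉Y)) (≤-pred (free Y uY Y⊑ (s≤s z≤n) ≤s)))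

  addPendants : ∀ B {V k} → Unique (B ++ V) → 1 ≤ length V → HighGirth V k → HighGirth (B ++ V) (length B + k)
  addPendants []      u        1≤ G = G
  addPendants (b ∷ B) {V} (b≢ ∷ u) 1≤ G = addPendant (All≢⇒∉ b≢)
    (≤-trans 1≤ (≤-trans (m≤n+m (length V) (length B)) (≤-reflexive (sym (length-++ B))))) (addPendants B u 1≤ G)

  -- Each vertex is joined to the head of the list after it, so the tree is a path.
  spanningTree : ∀ {v V} → Unique (v ∷ V) → HighGirth (v ∷ V) (length V)
  spanningTree {v} {[]} u = record
    { graph = λ _ _ → 0 ; symm = λ _ _ → refl ; irr = λ _ → refl
    ; free = λ X _ _ 1≤ _ → subst (_< length X) (sym (e-zero X (λ _ _ → refl))) 1≤ ; size = z≤n }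
  spanningTree {v} {w ∷ V} (v≢ ∷ u) = addPendant (All≢⇒∉ v≢) (s≤s z≤n) (spanningTree u)

  -- Deleting the given vertices one by one loses at most one edge each time, and the last vertex
  -- has no edge left.
  leaves⇒free : ∀ {f} → Symm f → Irrefl f → ∀ {V} →
    (∀ X → Unique X → X ⊑ V → 1 ≤ length X → length X ≤ s → ∃ λ x → x ∈ X × deg f x X ≤ 1) → ShortCycleFree f s V
  leaves⇒free {f} f-sym f-irr {V} leaf X uX X⊑ 1≤ ≤s = go (length X) X ≤-refl uX X⊑ 1≤ ≤s
    where
    open Components _≟_ f f-sym f-irr
    go : ∀ gas X → length X ≤ gas → Unique X → X ⊑ V → 1 ≤ length X → length X ≤ s → e f X < length X
    go zero      X X≤ uX X⊑ 1≤ ≤s = contradiction (≤-trans 1≤ X≤) λ ()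
    go (suc gas) X X≤ uX X⊑ 1≤ ≤s with leaf X uX X⊑ 1≤ ≤s
    ... | x , x∈ , d≤1 with remove uX x∈
    ...   | record { rest = [] ; perm = p } =
              subst₂ _<_ (sym (e-↭ f f-sym p)) (sym (↭-length p)) (s≤s z≤n)
    ...   | record { rest = R@(_ ∷ _) ; unique = uR ; sub = sub ; size = size ; e-eq = e-eq } =
              subst₂ _<_ (sym e-eq) (sym size) (s≤s (≤-trans (+-monoˡ-≤ (e f R) d≤1)
                (go gas R (≤-pred (subst (_≤ suc gas) size X≤)) uR (X⊑ ∘ sub) (s≤s z≤n)
                   (≤-trans (n≤1+n _) (subst (_≤ s) size ≤s)))))

  -- Positions count from the end, so that `V` itself is numbered by `downFrom`. A non-member gets
  -- 0, the number of the last entry; hence the membership hypotheses in `index-injective`.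
  index : List A → A → ℕ
  index []       u = 0
  index (x ∷ xs) u with u ≟ x
  ... | yes _ = length xs
  ... | no  _ = index xs u

  index-< : ∀ {V u} → u ∈ V → index V u < length V
  index-< {x ∷ xs} {u} u∈ with u ≟ x | u∈
  ... | yes _  | _         = ≤-refl
  ... | no u≢x | here u≡x  = contradiction u≡x u≢x
  ... | no _   | there u∈′ = ≤-trans (index-< u∈′) (n≤1+n _)

  index-injective : ∀ {V u v} → u ∈ V → v ∈ V → index V u ≡ index V v → u ≡ v
  index-injective {x ∷ xs} {u} {v} u∈ v∈ eq with u ≟ x | v ≟ x | u∈ | v∈
  ... | yes refl | yes refl | _        | _        = refl
  ... | no u≢x   | _        | here u≡x | _        = contradiction u≡x u≢x
  ... | _        | no v≢x   | _        | here v≡x = contradiction v≡x v≢x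
  ... | yes _    | no _     | _        | there q  = contradiction (sym eq) (<⇒≢ (index-< q))
  ... | no _     | yes _    | there p  | _        = contradiction eq (<⇒≢ (index-< p))
  ... | no _     | no _     | there p  | there q  = index-injective p q eq

  map-index : ∀ V → Unique V → map (index V) V ≡ downFrom (length V)
  map-index []      _        = refl
  map-index (x ∷ V) (x≢ ∷ u) with x ≟ x
  ... | no x≢x = contradiction refl x≢x
  ... | yes _  = cong (length V ∷_) (≡-trans (map-cong-∈ V (λ y∈ → old y∈)) (map-index V u))
    where
    map-cong-∈ : ∀ {g h : A → ℕ} xs → (∀ {y} → y ∈ xs → g y ≡ h y) → map g xs ≡ map h xs
    map-cong-∈ []       _  = refl
    map-cong-∈ (y ∷ ys) eq = cong₂ _∷_ (eq (here refl)) (map-cong-∈ ys (eq ∘ there))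
    old : ∀ {y} → y ∈ V → index (x ∷ V) y ≡ index V y
    old {y} y∈ with y ≟ x
    ... | yes refl = contradiction y∈ (All≢⇒∉ x≢)
    ... | no _     = refl

e-map : ∀ {A B : Set} (f : B → B → ℕ) (h : A → B) X → e f (map h X) ≡ e (λ x y → f (h x) (h y)) X
e-map f h []      = refl
e-map f h (x ∷ X) = cong₂ _+_ (cong sum (sym (map-∘ X))) (e-map f h X)

-- The cycle 0, 1, …, 2 + m.
module CycleGraph (m : ℕ) where

  next : ℕ → ℕ
  next j with j ≟ℕ 2 + m
  ... | yes _ = 0
  ... | no  _ = suc j

  next-last : next (2 + m) ≡ 0
  next-last with 2 + m ≟ℕ 2 + m
  ... | yes _  = refl
  ... | no ¬eq = contradiction refl ¬eq

  next-suc : ∀ {j} → j < 2 + m → next j ≡ suc j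
  next-suc {j} j< with j ≟ℕ 2 + m
  ... | yes refl = contradiction j< (<-irrefl refl)
  ... | no  _    = refl

  next-injective : ∀ {i j} → next i ≡ next j → i ≡ j
  next-injective {i} {j} eq with i ≟ℕ 2 + m | j ≟ℕ 2 + m
  ... | yes refl | yes refl = refl
  ... | no  _    | no _     = suc-injective eq

  next-≢ : ∀ j → j ≢ next j
  next-≢ j eq with j ≟ℕ 2 + m
  next-≢ j eq | no _     = contradiction (sym eq) 1+n≢n
  next-≢ j () | yes refl

  cyc : ℕ → ℕ → ℕ
  cyc i j = indicator (j ≟ℕ next i) + indicator (i ≟ℕ next j)

  cyc-sym : Symm cyc
  cyc-sym i j = +-comm (indicator (j ≟ℕ next i)) _

  cyc-irr : Irrefl cyc
  cyc-irr i = cong₂ _+_ (indicator-no (i ≟ℕ next i) (next-≢ i)) (indicator-no (i ≟ℕ next i) (next-≢ i))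

  e-cyc : 3 + m ≤ e cyc (downFrom (3 + m))
  e-cyc = subst (_≤ e cyc (downFrom (3 + m))) (length-downFrom (3 + m))
            (e-cycle cyc (linked (3 + m) ≤-refl) (∈-downFrom⁺ (s≤s z≤n))
              (≤-trans (≤-reflexive (sym (indicator-yes (0 ≟ℕ next (2 + m)) (sym next-last)))) (m≤m+n _ _)))
    where
    linked : ∀ k → k ≤ 3 + m → Linked (λ a b → 1 ≤ cyc a b) (downFrom k)
    linked 0             _  = []
    linked 1             _  = [-]
    linked (suc (suc k)) k≤ = ≤-trans (≤-reflexive
        (sym (indicator-yes (suc k ≟ℕ next k) (sym (next-suc (≤-pred k≤)))))) (m≤n+m _ _)
                              ∷ linked (suc k) (≤-trans (n≤1+n _) k≤)

  -- Climb from `i` to the last position, wrap around to 0, and climb to `j`.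
  next-closed⇒all : ∀ {I : ℕ → Set} {i} → i < 3 + m → I i → (∀ {j} → I j → I (next j)) → ∀ j → j < 3 + m → I j
  next-closed⇒all {I} {i} i< Ii cl = λ j j< → climb j 0 zero∈ j<
    where
    climb : ∀ d a → I a → a + d < 3 + m → I (a + d)
    climb zero    a Ia _ = subst I (sym (+-identityʳ a)) Ia
    climb (suc d) a Ia lt = subst I (sym (+-suc a d)) (climb d (suc a)
      (subst I (next-suc (≤-pred (≤-trans (s≤s (≤-trans (≤-reflexive (+-comm 1 a)) (+-monoʳ-≤ a (s≤s z≤n))))
          lt))) (cl Ia))
      (subst (_< 3 + m) (+-suc a d) lt))
    zero∈ : I 0
    zero∈ = subst I next-last (cl (subst I (m+[n∸m]≡n (≤-pred i<))
              (climb (2 + m ∸ i) i Ii (≤-reflexive (cong suc (m+[n∸m]≡n (≤-pred i<)))))))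

module _ {A : Set} (_≟_ : DecidableEquality A) (s : ℕ) where

  open Girth _≟_ s

  -- A nonempty set of at most `s` vertices is too small to be closed under `next`. A vertex whose
  -- successor is missing has only its predecessor as a possible neighbour in the set, so
  -- `leaves⇒free` applies.
  cycleOn : ∀ {m V} → Unique V → length V ≡ 3 + m → s < 3 + m → HighGirth V (3 + m)
  cycleOn {m} {V} u len s< = record
    { graph = g ; symm = g-sym ; irr = g-irr ; free = leaves⇒free g-sym g-irr leaf
    ; size = ≤-trans e-cyc (≤-reflexive (≡-trans
        (cong (e cyc) (≡-trans (cong downFrom (sym len)) (sym (map-index V u)))) (e-map cyc (index V) V))) }
    where
    open CycleGraph m
    ix : A → ℕ
    ix = index V
    g : A → A → ℕ
    g x y = cyc (ix x) (ix y)
    g-sym : Symm g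
    g-sym x y = cyc-sym (ix x) (ix y)
    g-irr : Irrefl g
    g-irr x = cyc-irr (ix x)
    leaf : ∀ X → Unique X → X ⊑ V → 1 ≤ length X → length X ≤ s → ∃ λ x → x ∈ X × deg g x X ≤ 1
    leaf X@(x₀ ∷ _) uX X⊑ _ X≤s with any? (λ x → ¬? (any? (λ y → ix y ≟ℕ next (ix x)) X)) X
    ... | yes p with find p
    ...   | x , x∈ , none = x , x∈ , ≤-trans (≤-reflexive (sum-map-cong X
              (λ {y} y∈ → cong (_+ indicator (ix x ≟ℕ next (ix y)))
                  (indicator-no (ix y ≟ℕ next (ix x)) (λ eq → none (lose y∈ eq))))))
              (sum-map-≤1 X uX (λ {y} _ → indicator-≤1 (ix x ≟ℕ next (ix y)))
                (λ {y} {z} y∈ z∈ p q → index-injective (X⊑ y∈) (X⊑ z∈) (next-injective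
                   (≡-trans (sym (indicator-true (ix x ≟ℕ next (ix y)) p)) (indicator-true (ix x ≟ℕ next (ix z)) q)))))
    leaf X@(x₀ ∷ _) uX X⊑ _ X≤s | no ¬p = contradiction X≤s (<⇒≱ (<-≤-trans s<
        (subst₂ _≤_ (length-upTo (3 + m)) (length-map ix X)
            (⊑⇒length≤ {X = upTo (3 + m)} {V = map ix X} (Unique.upTo⁺ (3 + m))
          (λ {j} j∈ → hit (all j (∈-upTo⁻ j∈)))))))
      where
      I : ℕ → Set
      I j = ∃ λ x → x ∈ X × ix x ≡ j
      hit : ∀ {j} → I j → j ∈ map ix X
      hit (x , x∈ , refl) = ∈-map⁺ ix x∈
      step : ∀ {j} → I j → I (next j)
      step (x , x∈ , refl) with any? (λ y → ix y ≟ℕ next (ix x)) X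
      ... | yes q = let (y , y∈ , eq) = find q in y , y∈ , eq
      ... | no ¬q = contradiction (lose x∈ ¬q) ¬p
      all : ∀ j → j < 3 + m → I j
      all = next-closed⇒all (subst (ix x₀ <_) len (index-< (X⊑ (here refl)))) (x₀ , here refl , refl) step

-- Exchanging the excess for a graph of high girth.

module _ {A : Set} (_≟_ : DecidableEquality A) (f : A → A → ℕ) (f-sym : Symm f) (f-irr : Irrefl f)
         (t : ℕ) (1≤t : 1 ≤ t) where

  open Components _≟_ f f-sym f-irr
  open Girth _≟_ (suc t)

  minDegree⇒¬closedTree : ∀ {V s} → Unique V → (∀ {v} → v ∈ V → 2 ≤ deg f v V) → ¬ ClosedTree V s
  minDegree⇒¬closedTree u large T with sparse⇒leaf (ClosedTree.tree T) (ClosedTree.sparse T)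
  ... | v , v∈ , leaf = contradiction (≤-trans (≤-reflexive (Closed⇒deg≡ u unique sub closed v∈)) leaf)
        (<⇒≱ (large (sub v∈)))
    where open ClosedTree T

  -- With minimum degree 2 the exploration from `Y` meets no tree component. It ends in an `s`-set
  -- with at least `e f Y − |Y| + s − 1` edges, and `t = s − 1` bounds these.
  closed⇒e≤length : ∀ {V Y} → Unique V → (∀ {v} → v ∈ V → 2 ≤ deg f v V) → suc t ≤ length V → LocalBound f (suc t) t V →
    Unique Y → Y ⊑ V → Closed f Y V → length Y ≤ suc t → e f Y ≤ length Y
  closed⇒e≤length {V} {Y} u large le sp uY Y⊑ cl Y≤
    with closedTree-or-dense (suc t) (suc t) Y u uY Y⊑ cl Y≤ (m≤n+m (suc t) (length Y)) le
  ... | inj₁ T = contradiction T (minDegree⇒¬closedTree u large)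
  ... | inj₂ X = linear 0 (+-mono-≤ dense (sp set unique sub size)) (arith (e f Y) t (e f set) (length Y))
    where
    open DenseSet X
    arith : ∀ a t b y → y + (a + suc t + b) ≡ a + (b + suc y + t) + 0
    arith = solve-∀

  -- The induction keeps at least `s` vertices, below which the local bound is silent. This forces a
  -- separate construction when a small component leaves a remainder with fewer than `s`.
  highGirth : ∀ gas V → length V ≤ gas → Unique V → suc t ≤ length V → LocalBound f (suc t) t V → HighGirth V (e f V)
  highGirth zero V V≤ u le sp = contradiction (≤-trans le V≤) λ ()
  highGirth (suc gas) V V≤ u le sp with suc t <? length V
  -- `V` is itself an `s`-set, so it has at most `s − 1` edges, as many as a spanning path.
  highGirth (suc gas) V@(v ∷ V′) V≤ u le sp | no V≮ = HighGirth-≤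
      (≤-trans (sp V u id (≤-antisym (≮⇒≥ V≮) le)) (≤-pred le)) (spanningTree u)
  highGirth (suc gas) V V≤ u le sp | yes s<V with small-or-large (λ x → deg f x V) 1 V
  ... | inj₁ (v , v∈ , d≤1) = HighGirth-↭ (↭-sym perm)
        (HighGirth-≤ (≤-trans (≤-reflexive e-eq) (+-monoˡ-≤ (e f rest) d≤1))
          (addPendant (head∉ (Unique-resp-↭ perm u)) (≤-trans (s≤s z≤n) rest≥)
            (highGirth gas rest (≤-pred (subst (_≤ suc gas) size V≤)) unique rest≥ (LocalBound-⊑ sub sp))))
    where
    open Removal (remove u v∈)
    rest≥ : suc t ≤ length rest
    rest≥ = ≤-pred (subst (suc t <_) size s<V)
    head∉ : ∀ {x xs} → Unique {A = A} (x ∷ xs) → x ∉ xs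
    head∉ (x≢ ∷ _) = All≢⇒∉ x≢
  ... | inj₂ large with short-or-free f-sym u
  ...   | inj₂ free = record { graph = f ; symm = f-sym ; irr = f-irr ; free = free ; size = ≤-refl }
  ...   | inj₁ K with grow (suc t) V (Short.set K) (suc t) (Short.unique K) (Short.sub K) (Short.short K)
        (m≤n+m (suc t) _)
  -- Grown from a dense set, an `s`-set would have at least `s` edges, one more than `t`.
  ...     | record { set = Z ; unique = uZ ; sub = Z⊑ ; gain = gain ; stop = inj₁ len } = contradiction
              (linear 0 (+-mono-≤ gain (+-mono-≤ (Short.dense K) (+-mono-≤ (sp Z uZ Z⊑ len) (≤-reflexive (sym len)))))
                (arith (e f (Short.set K)) (length (Short.set K)) (e f Z) (length Z) t))
              (1+n≰n {t})
    where
    arith : ∀ a k b z t → t + (a + z + (k + (b + suc t))) ≡ suc t + (b + k + (a + (t + z))) + 0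
    arith = solve-∀
  ...     | record { set = B ; unique = uB ; sub = B⊑ ; sup = K⊑B ; stop = inj₂ (B<s , clB) } with ⊑⇒↭ B uB B⊑
  ...       | R , p = finish (suc t ≤? length R)
    where
    len : length V ≡ length B + length R
    len = ≡-trans (↭-length p) (length-++ B)
    eV : e f V ≡ e f B + e f R
    eV = ≡-trans (e-↭ f f-sym p) (≡-trans (e-++ f B R)
           (≡-trans (cong (e f B + e f R +_) (Closed⇒cross≡0 u clB p)) (+-identityʳ _)))
    eB : e f B ≤ length B
    eB = closed⇒e≤length u large le sp uB B⊑ clB (<⇒≤ B<s)
    uBR : Unique (B ++ R)
    uBR = Unique-resp-↭ p u
    uR : Unique R
    uR = proj₁ (proj₂ (Unique-++⁻ B uBR))
    R⊑ : R ⊑ V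
    R⊑ x∈ = ∈-resp-↭ (↭-sym p) (∈-++⁺ʳ B x∈)
    clR : Closed f R V
    clR {z} {v} z∈ v∈ v∉ with ∈-++⁻ B (∈-resp-↭ p v∈)
    ... | inj₁ v∈B = ≡-trans (f-sym z v) (clB v∈B (R⊑ z∈) (λ z∈B → proj₂ (proj₂ (Unique-++⁻ B uBR)) z∈B z∈))
    ... | inj₂ v∈R = contradiction v∈R v∉
    R≤ : length R ≤ gas
    R≤ = ≤-pred (≤-trans (+-monoˡ-≤ (length R) (≤-trans (Short.nonempty K) (⊑⇒length≤ (Short.unique K) K⊑B)))
                         (≤-trans (≤-reflexive (sym len)) V≤))
    finish : Dec (suc t ≤ length R) → HighGirth V (e f V)
    -- At most `length B` edges are lost with `B`, and its vertices return as pendants with one edge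
    -- each.
    finish (yes s≤R) = HighGirth-↭ (↭-sym p) (HighGirth-≤ (≤-trans (≤-reflexive eV) (+-monoˡ-≤ (e f R) eB))
      (addPendants B uBR (≤-trans (s≤s z≤n) s≤R) (highGirth gas R R≤ uR s≤R (LocalBound-⊑ R⊑ sp))))
    -- Both parts are closed and small, so `e f V` is at most `length V`. A cycle through all of `V`
    -- attains that, and it is longer than `s`.
    finish (no s≰R) with m≤n⇒∃[o]m+o≡n (≤-trans (s≤s (s≤s 1≤t)) s<V)
    ... | m , eq = HighGirth-≤ (≤-trans (≤-reflexive eV)
          (≤-trans (+-mono-≤ eB eR) (≤-reflexive (≡-trans (sym len) (sym eq)))))
                     (cycleOn _≟_ (suc t) u (sym eq) (subst (suc t <_) (sym eq) s<V))
      where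
      eR : e f R ≤ length R
      eR = closed⇒e≤length u large le sp uR R⊑ clR (<⇒≤ (≰⇒> s≰R))

-- Edge counts and cycles in simple graphs.

Linked-tabulate : ∀ {A : Set} {R : A → A → Set} k (v : Fin (suc k) → A) →
  (∀ i → R (v (inject₁ i)) (v (suc i))) → Linked R (tabulate v)
Linked-tabulate zero    v h = [-]
Linked-tabulate (suc k) v h = h zero ∷ Linked-tabulate k (v ∘ suc) (h ∘ suc)

lookup-injective : ∀ {A : Set} {xs : List A} → Unique xs → Injective _≡_ _≡_ (lookup xs)
lookup-injective {xs = x ∷ xs} (x≢ ∷ u) {zero}  {zero}  eq = refl
lookup-injective {xs = x ∷ xs} (x≢ ∷ u) {zero}  {suc j} eq = contradiction eq (All.lookup x≢ (∈-lookup j))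
lookup-injective {xs = x ∷ xs} (x≢ ∷ u) {suc i} {zero}  eq = contradiction (sym eq) (All.lookup x≢ (∈-lookup i))
lookup-injective {xs = x ∷ xs} (x≢ ∷ u) {suc i} {suc j} eq = cong suc (lookup-injective u eq)

lookup-last : ∀ {A : Set} (x : A) as u → lookup (x ∷ as ++ [ u ]) (fromℕ (length (as ++ [ u ]))) ≡ u
lookup-last x []       u = refl
lookup-last x (a ∷ as) u = lookup-last a as u

Linked-lookup : ∀ {A : Set} {R : A → A → Set} {x xs} → Linked R (x ∷ xs) →
  (i : Fin (length xs)) → R (lookup (x ∷ xs) (inject₁ i)) (lookup xs i)
Linked-lookup (r ∷ l) zero    = r
Linked-lookup (r ∷ l) (suc i) = Linked-lookup l i

Linked-++⁻ˡ : ∀ {A : Set} {R : A → A → Set} xs {ys} → Linked R (xs ++ ys) → Linked R xs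
Linked-++⁻ˡ []           l       = []
Linked-++⁻ˡ (x ∷ [])     l       = [-]
Linked-++⁻ˡ (x ∷ y ∷ xs) (r ∷ l) = r ∷ Linked-++⁻ˡ (y ∷ xs) l

weight : ∀ {n} → SimpleGraph n → Fin n → Fin n → ℕ
weight G i j = if adj G i j then 1 else 0

module _ {n : ℕ} (G : SimpleGraph n) where

  open import Data.List.Membership.DecPropositional (Fin._≟_ {n}) using (_∈?_)

  weight-sym : Symm (weight G)
  weight-sym i j = cong (λ b → if b then 1 else 0) (SimpleGraph.sym G i j)

  weight-irr : Irrefl (weight G)
  weight-irr i = cong (λ b → if b then 1 else 0) (irrefl G i)

  weight-≤1 : ∀ i j → weight G i j ≤ 1
  weight-≤1 i j with adj G i j
  ... | true  = ≤-refl
  ... | false = z≤n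

  weight⇒adj : ∀ {i j} → 1 ≤ weight G i j → adj G i j ≡ true
  weight⇒adj {i} {j} 1≤ with adj G i j
  ... | true = refl

  adj⇒weight : ∀ {i j} → adj G i j ≡ true → 1 ≤ weight G i j
  adj⇒weight eq rewrite eq = ≤-refl

  open Components Fin._≟_ (weight G) weight-sym weight-irr

  Adj : Fin n → Fin n → Set
  Adj i j = 1 ≤ weight G i j

  free⇒noShortCycles : ∀ {s} → ShortCycleFree (weight G) s (allFin n) → NoShortCycles s G
  free⇒noShortCycles {s} free (suc (suc (suc k))) 3≤ ≤s (v , inj , adjs , close) =
    contradiction (e-cycle (weight G) (Linked-tabulate (2 + k) v (adj⇒weight ∘ adjs))
        (∈-tabulate⁺ {f = λ i → v (suc (suc i))} (fromℕ k))
                     (≤-trans (adj⇒weight close) (≤-reflexive (weight-sym (v (suc (suc (fromℕ k)))) (v zero)))))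
      (<⇒≱ (free (tabulate v) (Unique.tabulate⁺ inj) (λ {x} _ → ∈-tabulate⁺ x) (s≤s z≤n)
              (subst (_≤ s) (sym (length-tabulate v)) ≤s)))
  free⇒noShortCycles free 1 (s≤s ()) _ _
  free⇒noShortCycles free 2 (s≤s (s≤s ())) _ _

  -- Cutting the walk off behind `u` leaves a path that the edge from `u` to `x` closes; because `y`
  -- lies in between, the cycle has length at least 3.
  closeWalk : ∀ {x y u as bs} → Unique (x ∷ y ∷ as ++ u ∷ bs) → Linked Adj (x ∷ y ∷ as ++ u ∷ bs) → Adj x u →
    ∃ λ ℓ → 3 ≤ ℓ × ℓ ≤ length (x ∷ y ∷ as ++ u ∷ bs) × Cycle G ℓ
  closeWalk {x} {y} {u} {as} {bs} uq linked x~u =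
      length walk , s≤s (s≤s (≤-trans (m≤n+m 1 (length as)) (≤-reflexive (sym (length-++ as))))) , C≤ ,
      lookup walk , lookup-injective uC , (λ i → weight⇒adj (Linked-lookup lC i)) ,
      weight⇒adj (subst (λ z → Adj z x) (sym (lookup-last x (y ∷ as) u)) (≤-trans x~u (≤-reflexive (weight-sym x u))))
    where
    walk : List (Fin n)
    walk = x ∷ y ∷ as ++ [ u ]
    split : x ∷ y ∷ as ++ u ∷ bs ≡ walk ++ bs
    split = cong (λ l → x ∷ y ∷ l) (sym (++-assoc as [ u ] bs))
    uC : Unique walk
    uC = proj₁ (Unique-++⁻ walk (subst Unique split uq))
    lC : Linked Adj walk
    lC = Linked-++⁻ˡ walk (subst (Linked Adj) split linked)
    C≤ : length walk ≤ length (x ∷ y ∷ as ++ u ∷ bs)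
    C≤ = ≤-trans (m≤m+n (length walk) (length bs))
        (≤-reflexive (≡-trans (sym (length-++ walk)) (cong length (sym split))))

  -- The path is extended at its front `x`. A neighbour of `x` other than the previous vertex exists
  -- by the degree condition; it is either new, or on the path and closes a cycle. A path in `Y`
  -- cannot grow beyond `length Y`.
  minDegree⇒cycle : ∀ Y → (∀ {y} → y ∈ Y → 2 ≤ deg (weight G) y Y) → Unique Y → ∀ gas x ps →
    Unique (x ∷ ps) → (x ∷ ps) ⊑ Y → Linked Adj (x ∷ ps) → length Y ≤ length ps + gas →
    ∃ λ ℓ → 3 ≤ ℓ × ℓ ≤ length Y × Cycle G ℓ
  minDegree⇒cycle Y large uY zero x ps u p⊑ l Y≤ =
    contradiction (⊑⇒length≤ u p⊑) (<⇒≱ (s≤s (≤-trans Y≤ (≤-reflexive (+-identityʳ _)))))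
  minDegree⇒cycle Y large uY (suc gas) x ps u p⊑ l Y≤
    -- `take 1 ps` holds the previous vertex, or nothing at the start of the walk.
    with any? (λ v → (1 ≤? weight G x v) ×-dec ¬? (v ∈? take 1 ps)) Y
  ... | no none = contradiction (sum-map-≤1 Y uY (λ {y} _ → weight-≤1 x y) same) (<⇒≱ (large (p⊑ (here refl))))
    where
    back : ∀ {y} → y ∈ Y → Adj x y → y ∈ take 1 ps
    back {y} y∈ x~y with y ∈? take 1 ps
    ... | yes q = q
    ... | no ¬q = contradiction (lose y∈ (x~y , ¬q)) none
    same-head : ∀ {y z} (qs : List (Fin n)) → y ∈ take 1 qs → z ∈ take 1 qs → y ≡ z
    same-head (q ∷ qs) (here refl) (here refl) = refl
    same : ∀ {y z} → y ∈ Y → z ∈ Y → Adj x y → Adj x z → y ≡ z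
    same y∈ z∈ x~y x~z = same-head ps (back y∈ x~y) (back z∈ x~z)
  ... | yes q with find q
  ...   | v , v∈ , x~v , v∉head with v ∈? (x ∷ ps)
  ...     | no v∉ = minDegree⇒cycle Y large uY gas v (x ∷ ps) (∉⇒All≢ v∉ ∷ u)
                      (λ { (here refl) → v∈ ; (there r) → p⊑ r }) (≤-trans x~v (≤-reflexive (weight-sym x v)) ∷ l)
                      (≤-trans Y≤ (≤-reflexive (+-suc (length ps) gas)))
  ...     | yes (here refl) = contradiction (≤-trans x~v (≤-reflexive (weight-irr x))) λ ()
  ...     | yes (there v∈ps) with ps
  ...       | y ∷ zs with v∈ps
  ...         | here refl = contradiction (here refl) v∉head
  ...         | there v∈zs with ∈-∃++ v∈zs
  ...           | as , bs , refl with closeWalk {as = as} u l x~v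
  ...             | ℓ , 3≤ , ℓ≤ , cyc = ℓ , 3≤ , ≤-trans ℓ≤ (⊑⇒length≤ u p⊑) , cyc

  -- Deleting a vertex of degree at most 1 preserves having as many edges as vertices. A single
  -- vertex does not have this property, so the deletions stop at minimum degree 2.
  dense⇒cycle : ∀ gas X → length X ≤ gas → Unique X → 1 ≤ length X → length X ≤ e (weight G) X →
    ∃ λ ℓ → 3 ≤ ℓ × ℓ ≤ length X × Cycle G ℓ
  dense⇒cycle zero      X X≤ u 1≤ dense = contradiction (≤-trans 1≤ X≤) λ ()
  dense⇒cycle (suc gas) X X≤ u 1≤ dense with small-or-large (λ x → deg (weight G) x X) 1 X
  dense⇒cycle (suc gas) X@(x ∷ _) X≤ u 1≤ dense | inj₂ large =
    minDegree⇒cycle X large u (length X) x [] ([] ∷ []) (λ { (here refl) → here refl }) [-] ≤-refl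
  ... | inj₁ (v , v∈ , d≤1) with remove u v∈
  ...   | record { rest = [] ; perm = p } = contradiction
        (subst₂ _≤_ (↭-length p) (e-↭ (weight G) weight-sym p) dense) λ ()
  ...   | record { rest = R@(_ ∷ _) ; unique = uR ; size = size ; e-eq = e-eq }
          with dense⇒cycle gas R (≤-pred (subst (_≤ suc gas) size X≤)) uR (s≤s z≤n)
                 (≤-pred (≤-trans (subst₂ _≤_ size e-eq dense) (+-monoˡ-≤ (e (weight G) R) d≤1)))
  ...     | ℓ , 3≤ , ℓ≤ , cyc = ℓ , 3≤ , ≤-trans ℓ≤ (≤-trans (n≤1+n _) (≤-reflexive (sym size))) , cyc

  noShortCycles⇒free : ∀ {s} → NoShortCycles s G → ShortCycleFree (weight G) s (allFin n)
  noShortCycles⇒free nsc X u _ 1≤ X≤s = ≰⇒> λ dense →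
    let (ℓ , 3≤ , ℓ≤ , cyc) = dense⇒cycle (length X) X ≤-refl u 1≤ dense in nsc ℓ 3≤ (≤-trans ℓ≤ X≤s) cyc

-- Multigraphs on Fin n

module _ {A : Set} where

  e-filter : ∀ (b : A → Bool) (w : A → A → ℕ) xs →
    e (λ i j → if b i ∧ b j then w i j else 0) xs ≡ e w (filter (T? ∘ b) xs)
  e-filter b w [] = refl
  e-filter b w (x ∷ xs) with b x
  ... | false = cong₂ _+_ (sum-map-zero xs (λ _ → refl)) (e-filter b w xs)
  ... | true  = cong₂ _+_ (row xs) (e-filter b w xs)
    where
    row : ∀ ys → sum (map (λ j → if b j then w x j else 0) ys) ≡ deg w x (filter (T? ∘ b) ys)
    row []       = refl
    row (y ∷ ys) with b y
    ... | true  = cong (w x y +_) (row ys)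
    ... | false = row ys

  sum-map-concatMap : ∀ {B : Set} (H : B → ℕ) (F : A → List B) xs →
    sum (map H (concatMap F xs)) ≡ sum (map (λ x → sum (map H (F x))) xs)
  sum-map-concatMap H F []       = refl
  sum-map-concatMap H F (x ∷ xs) = ≡-trans (sum-map-++ H (F x) (concatMap F xs))
      (cong (sum (map H (F x)) +_) (sum-map-concatMap H F xs))

  -- Equality at 1 and 2 is why a construction with these two weights can match the upper bound.
  n≤2^n∸1 : ∀ n → n ≤ 2 ^ (n ∸ 1)
  n≤2^n∸1 0             = z≤n
  n≤2^n∸1 1             = ≤-refl
  n≤2^n∸1 (suc (suc n)) = ≤-trans (+-mono-≤ (m^n>0 2 n) (n≤2^n∸1 (suc n)))
                            (≤-reflexive (cong (2 ^ n +_) (sym (+-identityʳ _))))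

  product-≤-2^ : ∀ (g : A → ℕ) L → product (map g L) ≤ 2 ^ sum (map (λ x → g x ∸ 1) L)
  product-≤-2^ g []      = ≤-refl
  product-≤-2^ g (x ∷ L) = ≤-trans (*-mono-≤ (n≤2^n∸1 (g x)) (product-≤-2^ g L))
                             (≤-reflexive (sym (^-distribˡ-+-* 2 (g x ∸ 1) _)))

  product-2^ : ∀ (g : A → ℕ) L → product (map (λ x → 2 ^ g x) L) ≡ 2 ^ sum (map g L)
  product-2^ g []      = refl
  product-2^ g (x ∷ L) = ≡-trans (cong (2 ^ g x *_) (product-2^ g L)) (sym (^-distribˡ-+-* 2 (g x) _))

  product≢0⇒1≤ : ∀ (g : A → ℕ) {L} → product (map g L) ≢ 0 → ∀ {x} → x ∈ L → 1 ≤ g x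
  product≢0⇒1≤ g {y ∷ L} ≢0 (here refl) = n≢0⇒n>0 λ eq → ≢0 (cong (_* product (map g L)) eq)
  product≢0⇒1≤ g {y ∷ L} ≢0 (there x∈)  = product≢0⇒1≤ g (λ eq → ≢0 (≡-trans (cong (g y *_) eq) (*-zeroʳ (g y)))) x∈

  product-map-cong : ∀ {g h : A → ℕ} L → (∀ {x} → x ∈ L → g x ≡ h x) → product (map g L) ≡ product (map h L)
  product-map-cong []      eq = refl
  product-map-cong (x ∷ L) eq = cong₂ _*_ (eq (here refl)) (product-map-cong L (eq ∘ there))

module _ {n : ℕ} where

  Increasing : List (Fin n) → Set
  Increasing = AllPairs _<ᶠ_

  -- On an increasing list `e` reads only entries above the diagonal, the ones that a `Multigraph`
  -- uses.
  e-cong-< : ∀ {f g : Fin n → Fin n → ℕ} {xs} → Increasing xs → (∀ {i j} → i <ᶠ j → f i j ≡ g i j) → e f xs ≡ e g xs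
  e-cong-< []         eq = refl
  e-cong-< (x< ∷ inc) eq = cong₂ _+_ (sum-map-cong _ (λ y∈ → eq (All.lookup x< y∈))) (e-cong-< inc eq)

  upper : (Fin n → Fin n → ℕ) → Fin n → Fin n → ℕ
  upper h i j = if toℕ i <ᵇ toℕ j then h i j else 0

  upper-< : ∀ h {i j} → i <ᶠ j → upper h i j ≡ h i j
  upper-< h {i} {j} i<j with toℕ i <ᵇ toℕ j | <⇒<ᵇ i<j
  ... | true | _ = refl

  upper-≥ : ∀ h {i j} → toℕ j ≤ toℕ i → upper h i j ≡ 0
  upper-≥ h {i} {j} j≤i with toℕ i <ᵇ toℕ j in eq
  ... | true  = contradiction j≤i (<⇒≱ (<ᵇ⇒< (toℕ i) (toℕ j) (subst T (sym eq) tt)))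
  ... | false = refl

  sum-upper : ∀ h {xs} → Increasing xs → sum (map (λ i → deg (upper h) i xs) xs) ≡ e h xs
  sum-upper h []                       = refl
  sum-upper h {x ∷ xs} (x< ∷ inc) = cong₂ _+_
    (≡-trans (cong (_+ deg (upper h) x xs) (upper-≥ h {x} {x} ≤-refl))
        (sum-map-cong xs (λ y∈ → upper-< h (All.lookup x< y∈))))
    (≡-trans (sum-map-cong xs (λ {y} y∈ → cong (_+ deg (upper h) y xs) (upper-≥ h {y} {x} (<⇒≤ (All.lookup x< y∈)))))
             (sum-upper h inc))

  allFin-increasing : Increasing (allFin n)
  allFin-increasing = AllPairs.tabulate⁺-< id

  sum-pairs : ∀ h → sum (map (λ p → h (proj₁ p) (proj₂ p)) (pairs n)) ≡ e h (allFin n)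
  sum-pairs h = ≡-trans (sum-map-concatMap H row (allFin n))
                  (≡-trans (sum-map-cong (allFin n) (λ {i} _ → ≡-trans (sum-map-concatMap H (cell i) (allFin n))
                                                      (sum-map-cong (allFin n) (λ {j} _ → cell-sum i j))))
                           (sum-upper h allFin-increasing))
    where
    H : Fin n × Fin n → ℕ
    H p = h (proj₁ p) (proj₂ p)
    cell : Fin n → Fin n → List (Fin n × Fin n)
    cell i j = if toℕ i <ᵇ toℕ j then (i , j) ∷ [] else []
    row : Fin n → List (Fin n × Fin n)
    row i = concatMap (cell i) (allFin n)
    cell-sum : ∀ i j → sum (map H (cell i j)) ≡ upper h i j
    cell-sum i j with toℕ i <ᵇ toℕ j
    ... | true  = +-identityʳ _
    ... | false = refl

  ∈-pairs⁺ : ∀ {i j} → i <ᶠ j → (i , j) ∈ pairs n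
  ∈-pairs⁺ {i} {j} i<j = ∈-concatMap⁺ _ (lose (∈-allFin i) (∈-concatMap⁺ _ (lose (∈-allFin j) cell)))
    where
    cell : (i , j) ∈ (if toℕ i <ᵇ toℕ j then (i , j) ∷ [] else [])
    cell with toℕ i <ᵇ toℕ j | <⇒<ᵇ i<j
    ... | true | _ = here refl

  ∈-pairs⁻ : ∀ {p} → p ∈ pairs n → proj₁ p <ᶠ proj₂ p
  ∈-pairs⁻ {p} p∈ with find (∈-concatMap⁻ _ {xs = allFin n} p∈)
  ... | i , _ , p∈row with find (∈-concatMap⁻ _ {xs = allFin n} p∈row)
  ...   | j , _ , p∈cell with toℕ i <ᵇ toℕ j in eq
  ...     | true with p∈cell
  ...       | here refl = <ᵇ⇒< (toℕ i) (toℕ j) (subst T (sym eq) tt)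

  -- The entries of a `Multigraph` on and below the diagonal are arbitrary, while the graph lemmas
  -- require `Symm` and `Irrefl`.
  symmetrize : (Fin n → Fin n → ℕ) → Fin n → Fin n → ℕ
  symmetrize w i j = upper w i j + upper w j i

  symmetrize-sym : ∀ w → Symm (symmetrize w)
  symmetrize-sym w i j = +-comm (upper w i j) (upper w j i)

  symmetrize-irr : ∀ w → Irrefl (symmetrize w)
  symmetrize-irr w i = cong₂ _+_ (upper-≥ w {i} {i} ≤-refl) (upper-≥ w {i} {i} ≤-refl)

  symmetrize-< : ∀ w {i j} → i <ᶠ j → symmetrize w i j ≡ w i j
  symmetrize-< w {i} {j} i<j = ≡-trans (cong₂ _+_ (upper-< w i<j) (upper-≥ w {j} {i} (<⇒≤ i<j))) (+-identityʳ _)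

  elems : Subset n → List (Fin n)
  elems X = filter (T? ∘ Vec.lookup X) (allFin n)

  elems-increasing : ∀ X → Increasing (elems X)
  elems-increasing X = AllPairs.filter⁺ (T? ∘ Vec.lookup X) allFin-increasing

  elems-unique : ∀ X → Unique (elems X)
  elems-unique X = Unique.filter⁺ (T? ∘ Vec.lookup X) (Unique.allFin⁺ n)

  eInd≡e : ∀ w X → eInd w X ≡ e w (elems X)
  eInd≡e w X = ≡-trans (sum-pairs (λ i j → if Vec.lookup X i ∧ Vec.lookup X j then w i j else 0))
      (e-filter (Vec.lookup X) w (allFin n))

  P-cong : ∀ {w w′ : Multigraph n} → (∀ {i j} → i <ᶠ j → w i j ≡ w′ i j) → P w ≡ P w′
  P-cong eq = product-map-cong (pairs n) (λ p∈ → eq (∈-pairs⁻ p∈))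

  P≢0⇒1≤ : ∀ {w : Multigraph n} → P w ≢ 0 → ∀ {i j} → i <ᶠ j → 1 ≤ w i j
  P≢0⇒1≤ {w} ≢0 i<j = product≢0⇒1≤ (λ p → w (proj₁ p) (proj₂ p)) ≢0 (∈-pairs⁺ i<j)

  excess : Multigraph n → Multigraph n
  excess w i j = w i j ∸ 1

  -- A nonzero product forces all weights above the diagonal to be at least 1, so the truncated
  -- subtraction in `excess` is exact there.
  e-excess : ∀ {w : Multigraph n} → P w ≢ 0 → ∀ {xs} → Increasing xs → e w xs ≡ length xs C 2 + e (excess w) xs
  e-excess {w} ≢0 {xs} inc = ≡-trans (e-cong-< inc (λ i<j → sym (m+[n∸m]≡n (P≢0⇒1≤ ≢0 i<j))))
                               (≡-trans (e-+ (λ _ _ → 1) (excess w) xs) (cong (_+ e (excess w) xs) (e-one xs)))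

length-filter-tabulate : ∀ {A : Set} {n} (X : Subset n) (b : A → Bool) (g : Fin n → A) →
      (∀ i → b (g i) ≡ Vec.lookup X i) →
  length (filter (T? ∘ b) (tabulate g)) ≡ ∣ X ∣
length-filter-tabulate []      b g eq = refl
length-filter-tabulate (x ∷ X) b g eq with b (g zero) | x | eq zero
... | true  | true  | _ = cong suc (length-filter-tabulate X b (g ∘ suc) (eq ∘ suc))
... | false | false | _ = length-filter-tabulate X b (g ∘ suc) (eq ∘ suc)

length-elems : ∀ {n} (X : Subset n) → length (elems X) ≡ ∣ X ∣
length-elems X = length-filter-tabulate X (Vec.lookup X) id (λ _ → refl)

fromList : ∀ {n} → List (Fin n) → Subset n
fromList {n} xs = Vec.tabulate (λ i → does (i ∈? xs))
  where open import Data.List.Membership.DecPropositional (Fin._≟_ {n}) using (_∈?_)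

elems-fromList : ∀ {n} {xs : List (Fin n)} → Unique xs → elems (fromList xs) ↭ xs
elems-fromList {n} {xs} u = ⊑⊒⇒↭ (elems-unique (fromList xs)) u
    (λ {i} i∈ → sound i (proj₂ (∈-filter⁻ (T? ∘ Vec.lookup (fromList xs)) {xs = allFin n} i∈)))
    (λ {i} i∈ → ∈-filter⁺ (T? ∘ Vec.lookup (fromList xs)) (∈-allFin i) (complete i i∈))
  where
  open import Data.List.Membership.DecPropositional (Fin._≟_ {n}) using (_∈?_)
  lookup-eq : ∀ i → Vec.lookup (fromList xs) i ≡ does (i ∈? xs)
  lookup-eq = Vec.lookup∘tabulate (λ i → does (i ∈? xs))
  sound : ∀ i → T (Vec.lookup (fromList xs) i) → i ∈ xs
  sound i t with i ∈? xs | subst T (lookup-eq i) t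
  ... | yes p | _ = p
  complete : ∀ i → i ∈ xs → T (Vec.lookup (fromList xs) i)
  complete i i∈ with i ∈? xs | lookup-eq i
  ... | yes _ | eq = subst T (sym eq) tt
  ... | no ¬p | _  = contradiction i∈ ¬p

module _ {n s : ℕ} where

  InF⇒LocalBound : ∀ {q} {w : Multigraph n} → InF n s q w → LocalBound (symmetrize w) s q (allFin n)
  InF⇒LocalBound {q} {w} inF X u _ len = subst (_≤ q) eq (inF (fromList X) size)
    where
    size : ∣ fromList X ∣ ≡ s
    size = ≡-trans (sym (length-elems (fromList X))) (≡-trans (↭-length (elems-fromList u)) len)
    eq : eInd w (fromList X) ≡ e (symmetrize w) X
    eq = ≡-trans (eInd≡e w (fromList X))
           (≡-trans (sym (e-cong-< (elems-increasing (fromList X)) (symmetrize-< w)))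
                    (e-↭ (symmetrize w) (symmetrize-sym w) (elems-fromList u)))

  InF⇒LocalBound-excess : ∀ {t} {w : Multigraph n} → P w ≢ 0 → InF n s (s C 2 + t) w → LocalBound
        (symmetrize (excess w)) s t (allFin n)
  InF⇒LocalBound-excess {t} {w} ≢0 inF = InF⇒LocalBound {w = excess w} λ X len → +-cancelˡ-≤ (s C 2) _ _
    (subst (_≤ s C 2 + t)
      (≡-trans (eInd≡e w X) (≡-trans (e-excess ≢0 (elems-increasing X))
        (cong₂ _+_ (cong (_C 2) (≡-trans (length-elems X) len)) (sym (eInd≡e (excess w) X)))))
      (inF X len))

  upperBound : ∀ {t k} →
    (∀ f → Symm f → Irrefl f → LocalBound f s t (allFin n) → e f (allFin n) ≤ k) →
    ∀ w → InF n s (s C 2 + t) w → P w ≤ 2 ^ k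
  upperBound {t} {k} bound w inF with P w ≟ℕ 0
  ... | yes ≡0 = subst (_≤ 2 ^ k) (sym ≡0) z≤n
  ... | no  ≢0 = ≤-trans (product-≤-2^ (λ p → w (proj₁ p) (proj₂ p)) (pairs n)) (^-monoʳ-≤ 2
      (≤-trans (≤-reflexive (≡-trans (sum-pairs (excess w))
          (sym (e-cong-< allFin-increasing (symmetrize-< (excess w))))))
        (bound (symmetrize (excess w)) (symmetrize-sym (excess w)) (symmetrize-irr (excess w))
            (InF⇒LocalBound-excess ≢0 inF))))

  -- For values up to 1, `2 ^ f` is `1 + f`. The first form makes the product an exact power of 2,
  -- the second makes the sum over an `s`-set `s C 2` plus the excess.
  lowerBound : ∀ {t} f → (∀ i j → f i j ≤ 1) → (∀ (X : Subset n) → ∣ X ∣ ≡ s → e f (elems X) ≤ t) →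
    Σ (Multigraph n) λ w → InF n s (s C 2 + t) w × P w ≡ 2 ^ e f (allFin n)
  lowerBound {t} f f≤1 sparse = (λ i j → 2 ^ f i j) , inF ,
      ≡-trans (product-2^ (λ p → f (proj₁ p) (proj₂ p)) (pairs n)) (cong (2 ^_) (sum-pairs f))
    where
    2^-≤ : ∀ {m} → m ≤ 1 → 2 ^ m ≤ 1 + m
    2^-≤ z≤n       = ≤-refl
    2^-≤ (s≤s z≤n) = ≤-refl
    inF : InF n s (s C 2 + t) (λ i j → 2 ^ f i j)
    inF X len = begin
      eInd (λ i j → 2 ^ f i j) X                 ≡⟨ eInd≡e _ X ⟩
      e (λ i j → 2 ^ f i j) (elems X)            ≤⟨ e-mono (elems X) (λ i j → 2^-≤ (f≤1 i j)) ⟩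
      e (λ i j → 1 + f i j) (elems X)            ≡⟨ e-+ (λ _ _ → 1) f (elems X) ⟩
      e (λ _ _ → 1) (elems X) + e f (elems X)    ≡⟨ cong (_+ e f (elems X)) (e-one (elems X)) ⟩
      length (elems X) C 2 + e f (elems X)       ≡⟨ cong (λ k → k C 2 + e f (elems X)) (≡-trans (length-elems X) len) ⟩
      s C 2 + e f (elems X)                      ≤⟨ +-monoʳ-≤ (s C 2) (sparse X len) ⟩
      s C 2 + t                                  ∎
      where open ≤-Reasoning

  exΠ-2^ : ∀ {t k} → (Σ (Fin n → Fin n → ℕ) λ f → (∀ i j → f i j ≤ 1) ×
      (∀ (X : Subset n) → ∣ X ∣ ≡ s → e f (elems X) ≤ t) × k ≤ e f (allFin n)) →
    (∀ f → Symm f → Irrefl f → LocalBound f s t (allFin n) → e f (allFin n) ≤ k) → IsExΠ n s (s C 2 + t) (2 ^ k)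
  exΠ-2^ {t} {k} (f , f≤1 , sparse , k≤) bound with lowerBound f f≤1 sparse
  ... | w , inF , Pw = (w , inF , ≤-antisym (upperBound bound w inF)
        (≤-trans (^-monoʳ-≤ 2 k≤) (≤-reflexive (sym Pw)))) , upperBound bound

-- Existence of the extremal values

functions : ∀ {A : Set} k → List A → List (Fin k → A)
functions zero    as = (λ ()) ∷ []
functions (suc k) as = concatMap (λ a → map (VF._∷_ a) (functions k as)) as

-- Functions are matched pointwise, for want of extensionality. Leaving the relation general allows
-- two applications, one for the rows of a matrix and one for its entries.
functions-complete : ∀ {A : Set} {_~_ : A → A → Set} k {as} (f : Fin k → A) → (∀ i → Any (f i ~_) as) →
  Any (λ g → ∀ i → f i ~ g i) (functions k as)
functions-complete zero    f h = here λ ()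
functions-complete {_~_ = _~_} (suc k) {as} f h = Any.concat⁺ (Any.map⁺ (Any.map (λ f0~a → Any.map⁺ (Any.map
  (λ rest → λ { zero → f0~a ; (suc i) → rest i }) (functions-complete {_~_ = _~_} k (f ∘ suc) (h ∘ suc)))) (h zero)))

matrices : ∀ {A : Set} n → List A → List (Fin n → Fin n → A)
matrices n as = functions n (functions n as)

matrices-complete : ∀ {A : Set} n {as : List A} (w : Fin n → Fin n → A) → (∀ i j → w i j ∈ as) →
  ∃ λ g → g ∈ matrices n as × (∀ i j → w i j ≡ g i j)
matrices-complete n {as} w h = find (functions-complete {_~_ = λ f g → ∀ j → f j ≡ g j} n w
  (λ i → functions-complete {_~_ = _≡_} n (w i) (h i)))

maximal : ∀ {A : Set} (μ : A → ℕ) {Q : A → Set} → (∀ a → Dec (Q a)) → ∀ L a₀ → Q a₀ →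
  ∃ λ a → Q a × μ a₀ ≤ μ a × (∀ {b} → b ∈ L → Q b → μ b ≤ μ a)
maximal μ Q? []      a₀ q₀ = a₀ , q₀ , ≤-refl , λ ()
maximal μ {Q} Q? (x ∷ L) a₀ q₀ with maximal μ Q? L a₀ q₀ | Q? x
... | a , q , a₀≤ , max | no ¬q = a , q , a₀≤ , λ { (here refl) qb → contradiction qb ¬q ; (there b∈) → max b∈ }
... | a , q , a₀≤ , max | yes qx with μ x ≤? μ a
...   | yes x≤a = a , q , a₀≤ , λ { (here refl) _ → x≤a ; (there b∈) → max b∈ }
...   | no  x≰a = x , qx , ≤-trans a₀≤ a≤x , λ { (here refl) _ → ≤-refl ; (there b∈) qb → ≤-trans (max b∈ qb) a≤x }
  where
  a≤x : μ a ≤ μ x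
  a≤x = <⇒≤ (≰⇒> x≰a)

take-⊑ : ∀ {A : Set} k (xs : List A) → take k xs ⊑ xs
take-⊑ k xs x∈ = subst (_ ∈_) (take++drop≡id k xs) (∈-++⁺ˡ x∈)

length-take-≤ : ∀ {A : Set} {k} (xs : List A) → k ≤ length xs → length (take k xs) ≡ k
length-take-≤ {k = k} xs k≤ = ≡-trans (length-take k xs) (m≤n⇒m⊓n≡m k≤)

extend : ∀ {A : Set} {X V : List A} {s} → Unique V → Unique X → X ⊑ V → length X ≤ s → s ≤ length V →
  ∃ λ R → Unique (X ++ R) × (X ++ R) ⊑ V × length (X ++ R) ≡ s
extend {X = X} {V} {s} uV uX X⊑ X≤s s≤V with ⊑⇒↭ X uX X⊑
... | R , p = take k R , Unique-++⁺ uX (Unique.take⁺ k uR) (λ x∈ x∈R → dis x∈ (take-⊑ k R x∈R)) , sub ,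
    ≡-trans (length-++ X) (≡-trans (cong (length X +_) (length-take-≤ R k≤R)) (m+[n∸m]≡n X≤s))
  where
  k : ℕ
  k = s ∸ length X
  uR : Unique R
  uR = proj₁ (proj₂ (Unique-++⁻ X (Unique-resp-↭ p uV)))
  dis : ∀ {z} → z ∈ X → z ∉ R
  dis = proj₂ (proj₂ (Unique-++⁻ X (Unique-resp-↭ p uV)))
  sub : (X ++ take k R) ⊑ V
  sub x∈ with ∈-++⁻ X x∈
  ... | inj₁ x∈X = X⊑ x∈X
  ... | inj₂ x∈R = ∈-resp-↭ (↭-sym p) (∈-++⁺ʳ X (take-⊑ k R x∈R))
  k≤R : k ≤ length R
  k≤R = m≤n+o⇒m∸n≤o s (length X) (≤-trans s≤V (≤-reflexive (≡-trans (↭-length p) (length-++ X))))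

-- With `s ≤ length V`, every pair lies in some `s`-set and inherits its bound.
LocalBound⇒weight≤ : ∀ {A : Set} {f : A → A → ℕ} {s t V x y} → Unique V → 2 ≤ s → s ≤ length V → LocalBound f s t V →
  x ∈ V → y ∈ V → x ≢ y → f x y ≤ t
LocalBound⇒weight≤ {f = f} {x = x} {y} uV 2≤s s≤V sp x∈ y∈ x≢y
  with extend {X = x ∷ y ∷ []} uV ((x≢y ∷ []) ∷ [] ∷ []) (λ { (here refl) → x∈ ; (there (here refl)) → y∈ }) 2≤s s≤V
... | R , u , sub , len = ≤-trans (≤-trans (m≤m+n (f x y) (deg f x R)) (m≤m+n _ (e f (y ∷ R))))
      (sp (x ∷ y ∷ R) u sub len)

module _ {n : ℕ} where

  LocalBound⇒weights≤ : ∀ {f : Fin n → Fin n → ℕ} {s t} → Irrefl f → 2 ≤ s → s ≤ n → LocalBound f s t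
        (allFin n) → ∀ i j → f i j ≤ t
  LocalBound⇒weights≤ {s = s} {t} f-irr 2≤s s≤n sp i j with i Fin.≟ j
  ... | yes refl = subst (_≤ t) (sym (f-irr i)) z≤n
  ... | no  i≢j  = LocalBound⇒weight≤ (Unique.allFin⁺ n) 2≤s (subst (s ≤_) (sym (length-tabulate id)) s≤n) sp
                     (∈-allFin i) (∈-allFin j) i≢j

  InF? : ∀ s q (w : Multigraph n) → Dec (InF n s q w)
  InF? s q w with anySubset? (λ X → (∣ X ∣ ≟ℕ s) ×-dec ¬? (eInd w X ≤? q))
  ... | yes (X , len , ¬le) = no λ inF → ¬le (inF X len)
  ... | no  none            = yes λ X len → decidable-stable (eInd w X ≤? q) (λ ¬le → none (X , len , ¬le))

  InF-cong : ∀ {s q} {w w′ : Multigraph n} → (∀ {i j} → i <ᶠ j → w i j ≡ w′ i j) → InF n s q w → InF n s q w′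
  InF-cong {q = q} {w} {w′} eq inF X len = subst (_≤ q)
    (≡-trans (eInd≡e w X) (≡-trans (e-cong-< (elems-increasing X) eq) (sym (eInd≡e w′ X)))) (inF X len)

  -- For `s ≤ n` all weights are at most `q`, so a search through finitely many matrices finds the
  -- maximum. For `2 ≤ n < s` nothing bounds the weights; this is why the asymptotic ranges start at
  -- `n = s` or later.
  exΠ-exists : ∀ {s q} → 2 ≤ s → s ≤ n → ∃ λ m → IsExΠ n s q m
  exΠ-exists {s} {q} 2≤s s≤n
    with maximal P (InF? s q) (matrices n (upTo (suc q))) (λ _ _ → 0)
           (λ X _ → subst (_≤ q) (sym (≡-trans (eInd≡e _ X) (e-zero (elems X) (λ _ _ → refl)))) z≤n)
  ... | w , inF , _ , max = P w , (w , inF , refl) , bound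
    where
    bound : ∀ w′ → InF n s q w′ → P w′ ≤ P w
    -- The symmetrized weights are all bounded by `q`, whereas `w′` itself can be anything below the
    -- diagonal.
    bound w′ inF′ with matrices-complete n (symmetrize w′)
        (λ i j → ∈-upTo⁺ (s≤s (LocalBound⇒weights≤ (symmetrize-irr w′) 2≤s s≤n (InF⇒LocalBound {w = w′} inF′) i j)))
    ... | g , g∈ , eq = ≤-trans (≤-reflexive (P-cong same)) (max g∈ (InF-cong same inF′))
      where
      same : ∀ {i j} → i <ᶠ j → w′ i j ≡ g i j
      same i<j = ≡-trans (sym (symmetrize-< w′ i<j)) (eq _ _)

  ShortCycleFree-cong : ∀ {f g : Fin n → Fin n → ℕ} {s V} → (∀ i j → f i j ≡ g i j) → ShortCycleFree f s V →
        ShortCycleFree g s V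
  ShortCycleFree-cong eq free X u X⊑ 1≤ ≤s = subst (_< length X) (e-cong X (λ {x} {y} _ _ → eq x y)) (free X u X⊑ 1≤ ≤s)

  ShortCycleFree? : ∀ s (G : SimpleGraph n) → Dec (ShortCycleFree (weight G) s (allFin n))
  ShortCycleFree? s G with Girth.short-or-free Fin._≟_ s (weight-sym G) (Unique.allFin⁺ n)
  ... | inj₂ free = yes free
  ... | inj₁ K    = no λ free → <⇒≱ (free set unique sub nonempty short) dense
    where open Girth.Short K

  symmetrize-id : ∀ {f : Fin n → Fin n → ℕ} → Symm f → Irrefl f → ∀ i j → symmetrize f i j ≡ f i j
  symmetrize-id {f} f-sym f-irr i j with Fin.<-cmp i j
  ... | tri< i<j _ _    = symmetrize-< f i<j
  ... | tri≈ _ refl _   = ≡-trans (symmetrize-irr f i) (sym (f-irr i))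
  ... | tri> _ _ j<i    = ≡-trans (symmetrize-sym f i j) (≡-trans (symmetrize-< f j<i) (f-sym j i))

  simple : (f : Fin n → Fin n → ℕ) → Symm f → Irrefl f → SimpleGraph n
  simple f f-sym f-irr = record
    { adj    = λ i j → 1 ≤ᵇ f i j
    ; sym    = λ i j → cong (1 ≤ᵇ_) (f-sym i j)
    ; irrefl = λ i → cong (1 ≤ᵇ_) (f-irr i) }

  weight-simple : ∀ {f} f-sym f-irr {i j} → f i j ≤ 1 → weight (simple f f-sym f-irr) i j ≡ f i j
  weight-simple {f} f-sym f-irr {i} {j} f≤1 with f i j
  weight-simple f-sym f-irr z≤n       | 0 = refl
  weight-simple f-sym f-irr (s≤s z≤n) | 1 = refl

  edges≡e : ∀ (G : SimpleGraph n) → edges G ≡ e (weight G) (allFin n)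
  edges≡e G = sum-pairs (weight G)

  -- Symmetrizing turns every 0-1 matrix into a simple graph, and each graph arises from its own
  -- matrix. The maximum is taken over the decidable `ShortCycleFree` and then translated.
  exCycles-exists : ∀ s → ∃ λ m → IsExCycles n s m
  exCycles-exists s with maximal edges (ShortCycleFree? s) graphs (simple (λ _ _ → 0) (λ _ _ → refl) (λ _ → refl))
                           (λ X _ _ 1≤ _ → subst (_< length X) (sym (e-zero X (λ _ _ → refl))) 1≤)
    where
    fromMatrix : (Fin n → Fin n → ℕ) → SimpleGraph n
    fromMatrix h = simple (symmetrize h) (symmetrize-sym h) (symmetrize-irr h)
    graphs : List (SimpleGraph n)
    graphs = map fromMatrix (matrices n (upTo 2))
  ... | G , free , _ , max = edges G , (G , free⇒noShortCycles G free , refl) , bound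
    where
    bound : ∀ H → NoShortCycles s H → edges H ≤ edges G
    bound H nsc with matrices-complete n (weight H) (λ i j → ∈-upTo⁺ (s≤s (weight-≤1 H i j)))
    ... | h , h∈ , eq = ≤-trans
        (≤-reflexive (≡-trans (edges≡e H) (≡-trans (e-cong (allFin n) (λ {i} {j} _ _ → same i j)) (sym (edges≡e H′)))))
        (max (∈-map⁺ _ h∈) (ShortCycleFree-cong same (noShortCycles⇒free H nsc)))
      where
      H′ : SimpleGraph n
      H′ = simple (symmetrize h) (symmetrize-sym h) (symmetrize-irr h)
      sym-h : ∀ i j → symmetrize h i j ≡ weight H i j
      sym-h i j = ≡-trans (symmetrize-id (λ x y → ≡-trans (sym (eq x y)) (≡-trans (weight-sym H x y) (eq y x)))
                             (λ x → ≡-trans (sym (eq x x)) (weight-irr H x)) i j) (sym (eq i j))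
      same : ∀ i j → weight H i j ≡ weight H′ i j
      same i j = ≡-trans (sym (sym-h i j)) (sym (weight-simple (symmetrize-sym h) (symmetrize-irr h) {i} {j}
                   (subst (_≤ 1) (sym (sym-h i j)) (weight-≤1 H i j))))

  -- An extremal graph serves as the excess for the lower bound, and `highGirth` turns any
  -- admissible excess into a competitor of that graph for the upper bound.
  exΠ-cycles : ∀ {t} → 1 ≤ t → suc t ≤ n → ∃ λ m → IsExCycles n (suc t) m × IsExΠ n (suc t) (suc t C 2 + t) (2 ^ m)
  exΠ-cycles {t} 1≤t s≤n with exCycles-exists (suc t)
  ... | m , (G , nsc , edges-m) , max = m , ((G , nsc , edges-m) , max) , exΠ-2^
      (weight G , weight-≤1 G , sparse , ≤-reflexive (≡-trans (sym edges-m) (edges≡e G)))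
      bound
    where
    sparse : ∀ (X : Subset n) → ∣ X ∣ ≡ suc t → e (weight G) (elems X) ≤ t
    sparse X len = ≤-pred (subst (e (weight G) (elems X) <_) size
      (noShortCycles⇒free G nsc (elems X) (elems-unique X) (λ {x} _ → ∈-allFin x)
        (≤-trans (s≤s z≤n) (≤-reflexive (sym size))) (≤-reflexive size)))
      where
      size : length (elems X) ≡ suc t
      size = ≡-trans (length-elems X) len
    bound : ∀ f → Symm f → Irrefl f → LocalBound f (suc t) t (allFin n) → e f (allFin n) ≤ m
    bound f f-sym f-irr sp = ≤-trans size (≤-trans
        (≤-reflexive (≡-trans (e-cong (allFin n) (λ {i} {j} _ _ → same i j)) (sym (edges≡e H))))
        (max H (free⇒noShortCycles H (ShortCycleFree-cong same free))))
      where
      open Girth.HighGirth (highGirth Fin._≟_ f f-sym f-irr t 1≤t n (allFin n)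
          (≤-reflexive (length-tabulate id)) (Unique.allFin⁺ n)
             (subst (suc t ≤_) (sym (length-tabulate id)) s≤n) sp)
      H : SimpleGraph n
      H = simple graph symm irr
      graph-≤1 : ∀ i j → graph i j ≤ 1
      graph-≤1 i j with i Fin.≟ j
      ... | yes refl = subst (_≤ 1) (sym (irr i)) z≤n
      -- A pair of weight 2 would be a set with as many edges as vertices, which is excluded as
      -- `s ≥ 2`.
      ... | no  i≢j  = ≤-trans (≤-trans (m≤m+n _ 0) (m≤m+n _ 0))
            (≤-pred (free (i ∷ j ∷ []) ((i≢j ∷ []) ∷ [] ∷ []) (λ {x} _ → ∈-allFin x) (s≤s z≤n) (s≤s 1≤t)))
      same : ∀ i j → graph i j ≡ weight H i j
      same i j = sym (weight-simple symm irr (graph-≤1 i j))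

-- Graphs without large complete bipartite subgraphs

module _ {A : Set} {Q : A → Set} (Q? : ∀ x → Dec (Q x)) where

  length-filter-split : ∀ xs → length xs ≡ length (filter Q? xs) + length (filter (¬? ∘ Q?) xs)
  length-filter-split []       = refl
  length-filter-split (x ∷ xs) with Q? x
  ... | yes _ = cong suc (length-filter-split xs)
  ... | no  _ = ≡-trans (cong suc (length-filter-split xs)) (sym (+-suc (length (filter Q? xs)) _))

  sum-indicator : ∀ xs → sum (map (λ x → indicator (Q? x)) xs) ≡ length (filter Q? xs)
  sum-indicator []       = refl
  sum-indicator (x ∷ xs) with Q? x
  ... | yes _ = cong suc (sum-indicator xs)
  ... | no  _ = sum-indicator xs

module KőváriSósTurán {A : Set} (f : A → A → ℕ) (f-sym : Symm f) (f-irr : Irrefl f) where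

  edge : A → A → ℕ
  edge x y = indicator (1 ≤? f x y)

  edge-sym : Symm edge
  edge-sym x y = cong (λ k → indicator (1 ≤? k)) (f-sym x y)

  record Biclique (A′ B : List A) (k m : ℕ) : Set where
    field
      left     : List A
      right    : List A
      left-u   : Unique left
      right-u  : Unique right
      left-⊑   : left ⊑ A′
      right-⊑  : right ⊑ B
      left-#   : length left ≡ k
      right-#  : length right ≡ m
      complete : ∀ {x y} → x ∈ left → y ∈ right → 1 ≤ f y x

  trivial-biclique : ∀ A′ {B m} → Unique B → m ≤ length B → Biclique A′ B 0 m
  trivial-biclique A′ {B} {m} uB m≤ = record
    { left = [] ; right = take m B ; left-u = [] ; right-u = Unique.take⁺ m uB ; left-⊑ = λ () ; right-⊑ = take-⊑ m B
    ; left-# = refl ; right-# = length-take-≤ B m≤ ; complete = λ () }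

  -- Splitting B according to adjacency to the first vertex of A′ keeps at least half of B.
  biclique : ∀ A′ {B k m} → Unique A′ → Unique B → (∀ {b} → b ∈ B → k ≤ deg edge b A′) → m * 2 ^ length A′ ≤ length B →
    1 ≤ m → Biclique A′ B k m
  biclique A′ {B} {zero} {m} uA uB _ m≤ _ =
    trivial-biclique A′ uB (≤-trans (≤-trans (≤-reflexive (sym (*-identityʳ m)))
        (*-monoʳ-≤ m (m^n>0 2 (length A′)))) m≤)
  -- As `1 ≤ m`, the list `B` cannot be empty, yet a member of it would need `k + 1` neighbours in
  -- the empty list.
  biclique [] {[]} {suc k} {m} uA uB k≤ m≤ 1≤m = contradiction
      (≤-trans 1≤m (≤-trans (≤-reflexive (sym (*-identityʳ m))) m≤)) λ ()
  biclique [] {b ∷ B} {suc k} uA uB k≤ m≤ 1≤m = contradiction (k≤ (here refl)) λ ()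
  biclique (a ∷ A′) {B} {suc k} {m} (a≢ ∷ uA) uB k≤ m≤ 1≤m = choose (m * 2 ^ length A′ ≤? length B₁)
    where
    adj? : ∀ b → Dec (1 ≤ f b a)
    adj? b = 1 ≤? f b a
    B₁ B₀ : List A
    B₁ = filter adj? B
    B₀ = filter (¬? ∘ adj?) B
    choose : Dec (m * 2 ^ length A′ ≤ length B₁) → Biclique (a ∷ A′) B (suc k) m
    choose (yes m≤₁) = record
      { left = a ∷ left ; right = right ; left-u = ∉⇒All≢ (λ a∈ → All≢⇒∉ a≢ (left-⊑ a∈)) ∷ left-u ; right-u = right-u
      ; left-⊑ = λ { (here refl) → here refl ; (there p) → there (left-⊑ p) }
      ; right-⊑ = λ y∈ → proj₁ (∈-filter⁻ adj? {xs = B} (right-⊑ y∈))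
      ; left-# = cong suc left-# ; right-# = right-#
      ; complete = λ { (here refl) y∈ → proj₂ (∈-filter⁻ adj? {xs = B} (right-⊑ y∈)) ; (there p) y∈ → complete p y∈ } }
      where
      IH : Biclique A′ B₁ k m
      IH = biclique A′ uA (Unique.filter⁺ adj? uB)
             (λ {b} b∈ → ≤-pred (≤-trans (k≤ (proj₁ (∈-filter⁻ adj? {xs = B} b∈)))
                 (+-monoˡ-≤ (deg edge b A′) (indicator-≤1 (adj? b)))))
             m≤₁ 1≤m
      open Biclique IH
    choose (no ¬m≤₁) = record
      { left = left ; right = right ; left-u = left-u ; right-u = right-u
      ; left-⊑ = there ∘ left-⊑ ; right-⊑ = λ y∈ → proj₁ (∈-filter⁻ (¬? ∘ adj?) {xs = B} (right-⊑ y∈))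
      ; left-# = left-# ; right-# = right-# ; complete = complete }
      where
      half : m * 2 ^ length A′ ≤ length B₀
      half = linear 1 (+-mono-≤ m≤ (≰⇒> ¬m≤₁)) (≡-trans (arith m (2 ^ length A′) (length B₁) (length B₀))
               (cong (λ l → m * 2 ^ length A′ + (l + m * 2 ^ length A′) + 1) (sym (length-filter-split adj? B))))
        where
        arith : ∀ m p x y → y + (m * (2 * p) + suc x) ≡ m * p + (x + y + m * p) + 1
        arith = solve-∀
      IH : Biclique A′ B₀ (suc k) m
      IH = biclique A′ uA (Unique.filter⁺ (¬? ∘ adj?) uB)
             (λ {b} b∈ → let (b∈B , ¬adj) = ∈-filter⁻ (¬? ∘ adj?) {xs = B} b∈ in
               ≤-trans (k≤ b∈B) (≤-reflexive (cong (_+ deg edge b A′) (indicator-no (adj? b) ¬adj))))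
             half 1≤m
      open Biclique IH

  biclique⇒dense : ∀ {V A′ B k m t} → A′ ⊑ V → B ⊑ V → Biclique A′ B k m → LocalBound f (k + m) t V → k * m ≤ t
  biclique⇒dense {V} {k = k} {m} A⊑ B⊑ K sp = ≤-trans
      (≤-trans crossing (≤-trans (m≤n+m _ (e f left + e f right)) (≤-reflexive (sym (e-++ f left right)))))
      (sp (left ++ right) (Unique-++⁺ left-u right-u disjoint) sub
          (≡-trans (length-++ left) (cong₂ _+_ left-# right-#)))
    where
    open Biclique K
    -- The two sides come from possibly overlapping lists; a common vertex would carry weight on the
    -- diagonal.
    disjoint : ∀ {z} → z ∈ left → z ∉ right
    disjoint {z} z∈l z∈r = contradiction (≤-trans (complete z∈l z∈r) (≤-reflexive (f-irr z))) λ ()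
    sub : (left ++ right) ⊑ V
    sub x∈ with ∈-++⁻ left x∈
    ... | inj₁ p = A⊑ (left-⊑ p)
    ... | inj₂ p = B⊑ (right-⊑ p)
    crossing : k * m ≤ cross f left right
    crossing = subst (λ j → j * m ≤ cross f left right) left-# (sum-map-≥ m left (λ {x} x∈ →
      subst (_≤ deg f x right) (≡-trans (*-identityʳ _) right-#)
        (sum-map-≥ 1 right (λ {y} y∈ → ≤-trans (complete x∈ y∈) (≤-reflexive (f-sym y x))))))

  module _ (k m t D : ℕ) (1≤k : 1 ≤ k) (1≤m : 1 ≤ m) (1≤D : 1 ≤ D) where

    M : ℕ
    M = D * k

    1≤M : 1 ≤ M
    1≤M = *-mono-≤ 1≤D 1≤k

    -- Double counting of the edges between A′ and V yields |V| / M vertices with k neighbours in A′.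
    many-high⇒dense : ∀ {V A′} → Unique V → Unique A′ → A′ ⊑ V → length A′ ≡ M →
      (∀ {a} → a ∈ A′ → length V ≤ D * deg edge a V) → M * (m * 2 ^ M) ≤ length V → LocalBound f (k + m) t V → k * m ≤ t
    many-high⇒dense {V} {A′} uV uA A⊑ len high V≥ sp =
      biclique⇒dense A⊑ (λ b∈ → proj₁ (∈-filter⁻ good? {xs = V} b∈))
        (biclique A′ uA (Unique.filter⁺ good? uV) (λ b∈ → proj₂ (∈-filter⁻ good? {xs = V} b∈)) enough 1≤m) sp
      where
      good? : ∀ b → Dec (k ≤ deg edge b A′)
      good? b = k ≤? deg edge b A′
      G : List A
      G = filter good? V
      -- A vertex that is not good falls short of `k` by at least 1. Summed over `V`, this unit
      -- becomes the `length V` that good vertices must make up for, with at most `M` each.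
      pointwise : ∀ b → deg edge b A′ + 1 ≤ k + indicator (good? b) * M
      pointwise b with good? b
      ... | no ¬good = ≤-trans (≤-reflexive (+-comm _ 1)) (≤-trans (≰⇒> ¬good) (m≤m+n k _))
      ... | yes _    = ≤-trans (+-mono-≤ (≤-trans (sum-map-≤ 1 A′ (λ {a} _ → indicator-≤1 (1 ≤? f b a)))
                         (≤-reflexive (≡-trans (*-identityʳ _) (≡-trans len (sym (+-identityʳ M)))))) 1≤k)
                             (≤-reflexive (+-comm _ k))
      total : cross edge V A′ + length V * 1 ≤ length V * k + length G * M
      total = subst₂ _≤_
        (≡-trans (sum-map-+ (λ b → deg edge b A′) (λ _ → 1) V) (cong (cross edge V A′ +_) (sum-map-const 1 V)))
        (≡-trans (sum-map-+ (λ _ → k) (λ b → indicator (good? b) * M) V) (cong₂ _+_ (sum-map-const k V)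
          (≡-trans (sum-map-cong V (λ {b} _ → *-comm (indicator (good? b)) M))
            (≡-trans (sum-map-* M (λ b → indicator (good? b)) V)
                (≡-trans (cong (M *_) (sum-indicator good? V)) (*-comm M _))))))
        (sum-map-mono V (λ {b} _ → pointwise b))
      -- `M = D * k` is chosen for this: `M` vertices of degree at least `|V| / D` send on average
      -- `k` edges to each vertex of `V`.
      average : k * length V ≤ cross edge V A′
      average = *-cancelˡ-≤ D {{>-nonZero 1≤D}} (begin
        D * (k * length V)                       ≡⟨ sym (*-assoc D k (length V)) ⟩
        M * length V                             ≡⟨ cong (_* length V) (sym len) ⟩
        length A′ * length V                     ≤⟨ sum-map-≥ (length V) A′ high ⟩
        sum (map (λ a → D * deg edge a V) A′)    ≡⟨ sum-map-* D (λ a → deg edge a V) A′ ⟩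
        D * cross edge A′ V                      ≡⟨ cong (D *_) (cross-sym edge edge-sym A′ V) ⟩
        D * cross edge V A′                      ∎)
        where open ≤-Reasoning
      V≤ : length V ≤ M * length G
      V≤ = linear 0 (+-mono-≤ total average) (arith k (length V) (length G) M (cross edge V A′))
        where
        arith : ∀ k v g M x → M * g + (x + v * 1 + k * v) ≡ v + (v * k + g * M + x) + 0
        arith = solve-∀
      enough : m * 2 ^ length A′ ≤ length G
      enough = subst (λ j → m * 2 ^ j ≤ length G) (sym len) (*-cancelˡ-≤ M {{>-nonZero 1≤M}} (≤-trans V≥ V≤))

    -- Vertices of degree below `|V| / D` contribute at most `|V|` each to the left side. Fewer than
    -- `M` others exist, by `many-high⇒dense`, and each contributes at most `D * |V|`.
    few-high⇒sparse : ∀ {V} → Unique V → M * (m * 2 ^ M) ≤ length V → LocalBound f (k + m) t V → t < k * m →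
      D * cross edge V V ≤ length V * length V + M * (D * length V)
    few-high⇒sparse {V} uV V≥ sp t< with M ≤? length high
      where
      high : List A
      high = filter (λ v → length V ≤? D * deg edge v V) V
    ... | yes M≤ = contradiction (many-high⇒dense uV (Unique.take⁺ M (Unique.filter⁺ high? uV))
                     (λ a∈ → proj₁ (∈-filter⁻ high? {xs = V} (take-⊑ M high a∈)))
                     (length-take-≤ high M≤) (λ a∈ → proj₂ (∈-filter⁻ high? {xs = V} (take-⊑ M high a∈))) V≥ sp)
                         (<⇒≱ t<)
      where
      high? : ∀ v → Dec (length V ≤ D * deg edge v V)
      high? v = length V ≤? D * deg edge v V
      high : List A
      high = filter high? V
    ... | no M≰ = begin
        D * cross edge V V                                        ≡⟨ sym (sum-map-* D (λ v → deg edge v V) V) ⟩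
        sum (map (λ v → D * deg edge v V) V)                      ≤⟨ sum-map-mono V (λ {v} _ → pointwise v) ⟩
        sum (map (λ v → length V + D * length V * indicator (high? v)) V)
          ≡⟨ ≡-trans (sum-map-+ (λ _ → length V) (λ v → D * length V * indicator (high? v)) V)
               (cong₂ _+_ (sum-map-const (length V) V)
                   (≡-trans (sum-map-* (D * length V) (λ v → indicator (high? v)) V)
                       (cong (D * length V *_) (sum-indicator high? V)))) ⟩
        length V * length V + D * length V * length high
          ≤⟨ +-monoʳ-≤ (length V * length V) (≤-trans (*-monoʳ-≤ (D * length V) (<⇒≤ (≰⇒> M≰)))
              (≤-reflexive (*-comm (D * length V) M))) ⟩
        length V * length V + M * (D * length V)                  ∎
      where
      open ≤-Reasoning
      high? : ∀ v → Dec (length V ≤ D * deg edge v V)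
      high? v = length V ≤? D * deg edge v V
      high : List A
      high = filter high? V
      pointwise : ∀ v → D * deg edge v V ≤ length V + D * length V * indicator (high? v)
      pointwise v with high? v
      ... | no ¬high = ≤-trans (<⇒≤ (≰⇒> ¬high)) (m≤m+n _ _)
      ... | yes _    = ≤-trans (*-monoʳ-≤ D (≤-trans (sum-map-≤ 1 V (λ {y} _ → indicator-≤1 (1 ≤? f v y)))
            (≤-reflexive (*-identityʳ _))))
                         (≤-trans (≤-reflexive (sym (*-identityʳ _))) (m≤n+m _ (length V)))

  -- The choice D = bt + 1 makes both error terms at most D |V|².
  biclique-free⇒o[n²] : ∀ {k m t b V} → 1 ≤ k → 1 ≤ m → t < k * m → Unique V → (∀ {x y} → x ∈ V → y ∈ V → f x y ≤ t) →
    let M = suc (b * t) * k in b * t * M + M * (m * 2 ^ M) ≤ length V → LocalBound f (k + m) t V → b * e f V ≤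
        length V * length V
  biclique-free⇒o[n²] {k} {m} {t} {b} {V} 1≤k 1≤m t< uV f≤t V≥ sp =
    *-cancelˡ-≤ 2 (*-cancelˡ-≤ D (begin
      D * (2 * (b * e f V))                     ≡⟨ arith₁ D b (e f V) ⟩
      b * (D * (2 * e f V))                     ≡⟨ cong (λ x → b * (D * x)) (sym (handshake f f-sym f-irr V)) ⟩
      b * (D * cross f V V)                     ≤⟨ *-monoʳ-≤ b (*-monoʳ-≤ D weights) ⟩
      b * (D * (t * cross edge V V))            ≡⟨ arith₂ b D t (cross edge V V) ⟩
      b * t * (D * cross edge V V)
        ≤⟨ *-monoʳ-≤ (b * t) (few-high⇒sparse k m t D 1≤k 1≤m (s≤s z≤n) uV (≤-trans (m≤n+m _ (b * t * Mₖ)) V≥) sp t<) ⟩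
      b * t * (v * v + Mₖ * (D * v))            ≡⟨ arith₃ (b * t) v Mₖ D ⟩
      b * t * (v * v) + D * (v * (b * t * Mₖ))
        ≤⟨ +-mono-≤ (*-monoˡ-≤ (v * v) (n≤1+n (b * t))) (*-monoʳ-≤ D (*-monoʳ-≤ v (≤-trans (m≤m+n _ _) V≥))) ⟩
      D * (v * v) + D * (v * v)                 ≡⟨ arith₄ D (v * v) ⟩
      D * (2 * (v * v))                         ∎))
    where
    open ≤-Reasoning
    D : ℕ
    D = suc (b * t)
    v : ℕ
    v = length V
    Mₖ : ℕ
    Mₖ = D * k
    weight-edge : ∀ x y → x ∈ V → y ∈ V → f x y ≤ t * edge x y
    weight-edge x y x∈ y∈ with 1 ≤? f x y
    ... | yes _ = ≤-trans (f≤t x∈ y∈) (≤-reflexive (sym (*-identityʳ t)))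
    ... | no ¬p = ≤-trans (≤-pred (≰⇒> ¬p)) z≤n
    weights : cross f V V ≤ t * cross edge V V
    weights = ≤-trans (sum-map-mono V (λ {x} x∈ → ≤-trans (sum-map-mono V (λ {y} y∈ → weight-edge x y x∈ y∈))
                (≤-reflexive (sum-map-* t (edge x) V)))) (≤-reflexive (sum-map-* t (λ x → deg edge x V) V))
    arith₁ : ∀ D b x → D * (2 * (b * x)) ≡ b * (D * (2 * x))
    arith₁ = solve-∀
    arith₂ : ∀ b D t x → b * (D * (t * x)) ≡ b * t * (D * x)
    arith₂ = solve-∀
    arith₃ : ∀ c v M D → c * (v * v + M * (D * v)) ≡ c * (v * v) + D * (v * (c * M))
    arith₃ = solve-∀
    arith₄ : ∀ D x → D * x + D * x ≡ D * (2 * x)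
    arith₄ = solve-∀

-- Constructions and bounds

e-filter-≤ : ∀ {A : Set} (b : A → Bool) (f : A → A → ℕ) xs → e f (filter (T? ∘ b) xs) ≤ e f xs
e-filter-≤ b f xs = ≤-trans (≤-reflexive (sym (e-filter b f xs))) (e-mono xs restrict)
  where
  restrict : ∀ x y → (if b x ∧ b y then f x y else 0) ≤ f x y
  restrict x y with b x ∧ b y
  ... | true  = ≤-refl
  ... | false = z≤n

count-below : ∀ n t → t ≤ n → sum (tabulate {n = n} (λ i → if toℕ i <ᵇ t then 1 else 0)) ≡ t
count-below zero    zero    _         = refl
count-below (suc n) zero    _         = count-below n 0 z≤n
count-below (suc n) (suc t) (s≤s t≤n) = cong suc (count-below n t t≤n)

-- All edges start at vertex 0 and are entered in its row only, since the lists to be counted are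
-- increasing.
star : ℕ → ∀ {n} → Fin n → Fin n → ℕ
star t zero    (suc j) = if toℕ j <ᵇ t then 1 else 0
star t zero    zero    = 0
star t (suc i) j       = 0

star-≤1 : ∀ t {n} (i j : Fin n) → star t i j ≤ 1
star-≤1 t zero    zero    = z≤n
star-≤1 t (suc i) j       = z≤n
star-≤1 t zero    (suc j) with toℕ j <ᵇ t
... | true  = ≤-refl
... | false = z≤n

e-star : ∀ {n t} → t ≤ n → e (star t) (allFin (suc n)) ≡ t
e-star {n} {t} t≤n = ≡-trans (cong₂ _+_
    (≡-trans (cong sum (map-tabulate suc (f zero))) (count-below n t t≤n))
    (≡-trans (cong (e f) (sym (map-tabulate id suc)))
        (≡-trans (e-map f suc (allFin n)) (e-zero (allFin n) (λ _ _ → refl)))))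
  (+-identityʳ t)
  where
  f : Fin (suc n) → Fin (suc n) → ℕ
  f = star t

exΠ-few : ∀ {n s t} → 2 * t + 2 ≤ s → s ≤ n → IsExΠ n s (s C 2 + t) (2 ^ t)
exΠ-few {zero}  {s} {t} t≤ s≤n = contradiction (≤-trans t≤ s≤n)
    (λ le → contradiction (≤-trans (m≤n+m 2 (2 * t)) le) λ ())
exΠ-few {suc n} {s} {t} t≤ s≤n = exΠ-2^
    (star t , star-≤1 t , (λ X _ → ≤-trans (e-filter-≤ (Vec.lookup X) (star t) (allFin (suc n)))
        (≤-reflexive star-e)) , ≤-reflexive (sym star-e))
    (λ f f-sym f-irr → Components.few-edges Fin._≟_ f f-sym f-irr (suc n ∸ s) s t (allFin (suc n)) t≤
        (Unique.allFin⁺ (suc n))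
       (≡-trans (length-tabulate id) (sym (m+[n∸m]≡n s≤n))))
  where
  star-e : e (star t) (allFin (suc n)) ≡ t
  star-e = e-star (≤-pred (≤-trans (linear (t + 1) t≤ (arith t s)) s≤n))
    where
    arith : ∀ t s → s + (2 * t + 2) ≡ suc t + s + (t + 1)
    arith = solve-∀

increasing-length : ∀ {n} {X : List (Fin n)} lo {hi} → Increasing X → lo ≤ hi →
      (∀ {x} → x ∈ X → lo ≤ toℕ x × toℕ x < hi) → lo + length X ≤ hi
increasing-length lo [] lo≤hi _ = ≤-trans (≤-reflexive (+-identityʳ lo)) lo≤hi
increasing-length {X = x ∷ xs} lo (x< ∷ inc) lo≤hi within = ≤-trans (≤-reflexive (+-suc lo (length xs)))
  (≤-trans (+-monoˡ-≤ (length xs) (s≤s (proj₁ (within (here refl)))))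
    (increasing-length (suc (toℕ x)) inc (proj₂ (within (here refl)))
        (λ y∈ → All.lookup x< y∈ , proj₂ (within (there y∈)))))

-- The paths on the blocks [kc, (k + 1)c).
module Blocks (c : ℕ) .{{_ : NonZero c}} where

  path? : ∀ a b → Dec (suc a ≡ b × a / c ≡ b / c)
  path? a b = (suc a ≟ℕ b) ×-dec (a / c ≟ℕ b / c)

  path : ℕ → ℕ → ℕ
  path a b = indicator (path? a b)

  run : ℕ → ℕ → List ℕ
  run a zero    = []
  run a (suc m) = a ∷ run (suc a) m

  map-toℕ : ∀ {m n} a (g : Fin m → Fin n) → (∀ i → toℕ (g i) ≡ a + toℕ i) → map toℕ (tabulate g) ≡ run a m
  map-toℕ {zero}  a g eq = refl
  map-toℕ {suc m} a g eq = cong₂ _∷_ (≡-trans (eq zero) (+-identityʳ a))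
      (map-toℕ (suc a) (g ∘ suc) (λ i → ≡-trans (eq (suc i)) (+-suc a (toℕ i))))

  -- Each of the `m` steps from a number to its successor is either an edge or crosses a block
  -- boundary and raises the quotient by `c`.
  e-run : ∀ m a → m + a / c ≤ e path (run a (suc m)) + (a + m) / c
  e-run zero    a = /-monoˡ-≤ c (m≤m+n a 0)
  e-run (suc m) a with path? a (suc a) | e-run m (suc a)
  ... | yes (_ , eq) | IH = s≤s (begin
      m + a / c                                                       ≡⟨ cong (m +_) eq ⟩
      m + suc a / c                                                   ≤⟨ IH ⟩
      e path (run (suc a) (suc m)) + (suc a + m) / c                  ≡⟨ cong
          (λ k → e path (run (suc a) (suc m)) + k / c) (sym (+-suc a m)) ⟩
      e path (run (suc a) (suc m)) + (a + suc m) / c                  ≤⟨ +-monoˡ-≤ ((a + suc m) / c)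
          (m≤n+m (e path (run (suc a) (suc m))) (deg path a (run (suc (suc a)) m))) ⟩
      deg path a (run (suc (suc a)) m) + e path (run (suc a) (suc m)) + (a + suc m) / c ∎)
    where open ≤-Reasoning
  ... | no ¬p | IH = begin
      suc m + a / c                                                   ≡⟨ sym (+-suc m (a / c)) ⟩
      m + suc (a / c)                                                 ≤⟨ +-monoʳ-≤ m
          (≤∧≢⇒< (/-monoˡ-≤ c (n≤1+n a)) (λ eq → ¬p (refl , eq))) ⟩
      m + suc a / c                                                   ≤⟨ IH ⟩
      e path (run (suc a) (suc m)) + (suc a + m) / c                  ≡⟨ cong
          (λ k → e path (run (suc a) (suc m)) + k / c) (sym (+-suc a m)) ⟩
      e path (run (suc a) (suc m)) + (a + suc m) / c                  ≤⟨ +-monoˡ-≤ ((a + suc m) / c)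
          (m≤n+m (e path (run (suc a) (suc m))) (deg path a (run (suc (suc a)) m))) ⟩
      deg path a (run (suc (suc a)) m) + e path (run (suc a) (suc m)) + (a + suc m) / c ∎
    where open ≤-Reasoning

  module _ {n : ℕ} where

    blockPath : Fin n → Fin n → ℕ
    blockPath i j = path (toℕ i) (toℕ j)

    blockPath-≤1 : ∀ i j → blockPath i j ≤ 1
    blockPath-≤1 i j = indicator-≤1 (path? (toℕ i) (toℕ j))

    deg-blockPath : ∀ {x ys} → Increasing ys → deg blockPath x ys ≤ 1
    deg-blockPath {x} {ys} inc = sum-map-≤1 ys (AllPairs.map Fin.<⇒≢ inc) (λ {y} _ → blockPath-≤1 x y)
      (λ {y} {z} _ _ p q → Fin.toℕ-injective (≡-trans (sym (proj₁ (indicator-true (path? (toℕ x) (toℕ y)) p)))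
                                                       (proj₁ (indicator-true (path? (toℕ x) (toℕ z)) q))))

    -- The number of vertices exceeds the number of edges by at least the number of blocks met,
    -- which matters only as 0, 1 or at least 2. A single block is remembered to tell whether the
    -- next vertex opens another.
    data Spread : List (Fin n) → Set where
      empty  : Spread []
      block  : ∀ {X} b → (∀ {x} → x ∈ X → toℕ x / c ≡ b) → e blockPath X + 1 ≤ length X → Spread X
      blocks : ∀ {X} → e blockPath X + 2 ≤ length X → Spread X

    spread : ∀ {X} → Increasing X → Spread X
    spread [] = empty
    spread {x ∷ xs} (x< ∷ inc) with spread inc
    ... | empty     = block (toℕ x / c) (λ { (here refl) → refl }) ≤-refl
    ... | blocks le = blocks (≤-trans (≤-reflexive (+-assoc (deg blockPath x xs) _ 2))
          (+-mono-≤ (deg-blockPath inc) le))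
    ... | block b same le with toℕ x / c ≟ℕ b
    ...   | yes eq = block b (λ { (here refl) → eq ; (there y∈) → same y∈ })
                       (≤-trans (≤-reflexive (+-assoc (deg blockPath x xs) _ 1)) (+-mono-≤ (deg-blockPath inc) le))
    ...   | no ¬eq = blocks (≤-trans (≤-reflexive
          (≡-trans (cong (λ d → d + e blockPath xs + 2) isolated) (+-suc (e blockPath xs) 1))) (s≤s le))
      where
      isolated : deg blockPath x xs ≡ 0
      isolated = sum-map-zero xs (λ {y} y∈ → indicator-no (path? (toℕ x) (toℕ y))
          (λ (_ , eq) → ¬eq (≡-trans eq (same y∈))))

    block-length : ∀ {X : List (Fin n)} b → Increasing X → (∀ {x} → x ∈ X → toℕ x / c ≡ b) → length X ≤ c
    block-length {X} b inc same = +-cancelˡ-≤ (b * c) _ _ (increasing-length (b * c) inc (m≤m+n (b * c) c) within)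
      where
      within : ∀ {x} → x ∈ X → b * c ≤ toℕ x × toℕ x < b * c + c
      within {x} x∈ rewrite sym (same x∈) = m/n*n≤m (toℕ x) c ,
        ≤-trans (s≤s (≤-reflexive (m≡m%n+[m/n]*n (toℕ x) c)))
            (≤-trans (+-monoˡ-≤ _ (m%n<n (toℕ x) c)) (≤-reflexive (+-comm c _)))

    -- More than `c` vertices meet two blocks. With `c = s − 1` this is the bound `s − 2` on the
    -- edges of an `s`-set.
    e-blockPath-≤ : ∀ {X} → Increasing X → suc c ≤ length X → e blockPath X + 2 ≤ length X
    e-blockPath-≤ {X} inc c<X with spread inc
    ... | block b same _ = contradiction (block-length b inc same) (<⇒≱ c<X)
    ... | blocks le      = le

  e-blockPath-≥ : ∀ n → n ≤ e blockPath (allFin (suc n)) + n / c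
  e-blockPath-≥ n = begin
    n                                                 ≤⟨ m≤m+n n _ ⟩
    n + 0 / c                                         ≤⟨ e-run n 0 ⟩
    e path (run 0 (suc n)) + n / c                    ≡⟨ cong (λ l → e path l + n / c)
        (sym (map-toℕ {suc n} 0 id (λ _ → refl))) ⟩
    e path (map toℕ (allFin (suc n))) + n / c         ≡⟨ cong (_+ n / c) (e-map path toℕ (allFin (suc n))) ⟩
    e blockPath (allFin (suc n)) + n / c              ∎
    where open ≤-Reasoning

exΠ-blocks : ∀ {n} t → 2 + t ≤ n → IsExΠ n (2 + t) ((2 + t) C 2 + t) (2 ^ ((t * n) / suc t))
exΠ-blocks {suc n} t s≤n = exΠ-2^ (blockPath , blockPath-≤1 , sparse , large) bound
  where
  c : ℕ
  c = suc t
  open Blocks c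
  sparse : ∀ X → ∣ X ∣ ≡ 2 + t → e blockPath (elems X) ≤ t
  sparse X len = +-cancelʳ-≤ 2 _ _ (≤-trans (e-blockPath-≤ (elems-increasing X) (≤-reflexive (sym size)))
                   (≤-reflexive (≡-trans size (+-comm 2 t))))
    where
    size : length (elems X) ≡ 2 + t
    size = ≡-trans (length-elems X) len
  large : (t * suc n) / c ≤ e blockPath (allFin (suc n))
  large with (t * suc n) / c ≤? e blockPath (allFin (suc n))
  ... | yes le = le
  -- Write y and z for the floors of `t (n + 1) / c` and `n / c`. Then c(y + z) is at most
  -- `c n + t`, less than `c (n + 1)`, while too few edges would force y + z to be at least `n + 1`.
  ... | no nle = contradiction (linear 0 (+-mono-≤ (+-mono-≤ (m/n*n≤m (t * suc n) c) (m/n*n≤m n c))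
                   (*-monoʳ-≤ c (+-mono-≤ (≰⇒> nle) (e-blockPath-≥ n))))
                   (arith t n ((t * suc n) / c) (n / c) (e blockPath (allFin (suc n)))))
                 (1+n≰n {n})
    where
    arith : ∀ t n y z x → n + (y * suc t + z * suc t + suc t * (suc x + n)) ≡ suc n +
          (t * suc n + n + suc t * (y + (x + z))) + 0
    arith = solve-∀
  bound : ∀ f → Symm f → Irrefl f → LocalBound f (2 + t) t (allFin (suc n)) → e f (allFin (suc n)) ≤ (t * suc n) / c
  bound f f-sym f-irr sp = ≤-trans (≤-reflexive (sym (m*n/n≡m (e f (allFin (suc n))) c)))
    (/-monoˡ-≤ c (≤-trans (≤-reflexive (*-comm _ c)) (subst (λ l → c * e f (allFin (suc n)) ≤ t * l) len
      (Components.forest-bound Fin._≟_ f f-sym f-irr t (suc n) (allFin (suc n)) (≤-reflexive len)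
          (Unique.allFin⁺ (suc n))
        (subst (2 + t ≤_) (sym len) s≤n) sp))))
    where
    len : length (allFin (suc n)) ≡ suc n
    len = length-tabulate id

exΠ-zero : ∀ {n s q} → 2 ≤ s → q < s C 2 → s ≤ n → IsExΠ n s q 0
exΠ-zero {n} {s} {q} 2≤s q< s≤n = ((λ _ _ → 0) , zero-InF , vanishes _ zero-InF) , λ w inF → ≤-reflexive
    (vanishes w inF)
  where
  zero-InF : InF n s q (λ _ _ → 0)
  zero-InF X _ = subst (_≤ q) (sym (≡-trans (eInd≡e _ X) (e-zero (elems X) (λ _ _ → refl)))) z≤n
  vanishes : ∀ w → InF n s q w → P w ≡ 0
  vanishes w inF with P w ≟ℕ 0
  ... | yes ≡0 = ≡0
  ... | no ≢0 with extend {X = []} (Unique.allFin⁺ n) [] (λ ()) z≤n (subst (s ≤_) (sym (length-tabulate id)) s≤n)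
  ...   | R , u , _ , len = contradiction (≤-trans (≤-trans (m≤m+n _ _) (≤-reflexive (sym count)))
        (inF (fromList R) (≡-trans (sym (length-elems (fromList R))) size)))
                              (<⇒≱ q<)
    where
    size : length (elems (fromList R)) ≡ s
    size = ≡-trans (↭-length (elems-fromList u)) len
    count : eInd w (fromList R) ≡ s C 2 + e (excess w) (elems (fromList R))
    count = ≡-trans (eInd≡e w (fromList R)) (≡-trans (e-excess ≢0 (elems-increasing (fromList R)))
        (cong (λ k → k C 2 + e (excess w) (elems (fromList R))) size))

exΠ-≥ : ∀ {n s t m} → IsExΠ n s (s C 2 + t) m → ∀ f → (∀ i j → f i j ≤ 1) →
  (∀ (X : Subset n) → ∣ X ∣ ≡ s → e f (elems X) ≤ t) → 2 ^ e f (allFin n) ≤ m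
exΠ-≥ {m = m} (_ , max) f f≤1 sparse with lowerBound f f≤1 sparse
... | w , inF , Pw = subst (_≤ m) Pw (max w inF)

exΠ-≤ : ∀ {n s t m k} → IsExΠ n s (s C 2 + t) m →
  (∀ f → Symm f → Irrefl f → LocalBound f s t (allFin n) → e f (allFin n) ≤ k) → m ≤ 2 ^ k
exΠ-≤ {k = k} ((w , inF , Pw) , _) bound = subst (_≤ 2 ^ k) Pw (upperBound bound w inF)

LocalBound-weaken : ∀ {A : Set} {f : A → A → ℕ} {s t t′ V} → t ≤ t′ → LocalBound f s t V → LocalBound f s t′ V
LocalBound-weaken t≤t′ sp X u X⊑ len = ≤-trans (sp X u X⊑ len) t≤t′

module Matching where

  -- A path on a block of two vertices is a single edge, so `blockPath` is now a matching.
  open Blocks 2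

  module _ {n : ℕ} {x y : Fin n} {ys : List (Fin n)} (x<y : x <ᶠ y) (y< : All (y <ᶠ_) ys) where

    -- If `x` and `y` are matched, neither has another edge and both are dropped. If not, `x` has no
    -- edge at all, as its only possible partner `x + 1` is not beyond `y`, and `x` alone is
    -- dropped. Hence the two hypotheses.
    e-matching-∷ : 2 * e blockPath ys ≤ length ys → 2 * e blockPath (y ∷ ys) ≤ length (y ∷ ys) →
      2 * e blockPath (x ∷ y ∷ ys) ≤ length (x ∷ y ∷ ys)
    e-matching-∷ IH₂ IH₁ with path? (toℕ x) (toℕ y)
    ... | yes (y≡ , same) = begin
        2 * (1 + deg blockPath x ys + (deg blockPath y ys + e blockPath ys))
          ≡⟨ cong₂ (λ a b → 2 * (1 + a + (b + e blockPath ys))) x-ys y-ys ⟩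
        2 * (1 + e blockPath ys)     ≡⟨ *-distribˡ-+ 2 1 (e blockPath ys) ⟩
        2 + 2 * e blockPath ys       ≤⟨ +-monoʳ-≤ 2 IH₂ ⟩
        2 + length ys                ∎
      where
      open ≤-Reasoning
      x-ys : deg blockPath x ys ≡ 0
      x-ys = sum-map-zero ys (λ {z} z∈ → indicator-no (path? (toℕ x) (toℕ z))
          (λ (z≡ , _) → <⇒≢ (All.lookup y< z∈) (≡-trans (sym y≡) z≡)))
      y-ys : deg blockPath y ys ≡ 0
      -- `y` is `x + 1` in the block of `x`, and `y + 1 = x + 2` already lies in the next block.
      y-ys = sum-map-zero ys (λ {z} z∈ → indicator-no (path? (toℕ y) (toℕ z)) (λ (z≡ , same′) → contradiction
               (≡-trans (≡-trans same same′) (≡-trans (cong (_/ 2) (≡-trans (sym z≡) (cong suc (sym y≡))))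
                 (m/n≡1+[m∸n]/n {2 + toℕ x} {2} (s≤s (s≤s z≤n)))))
               (λ eq → contradiction (sym eq) 1+n≢n)))
    ... | no ¬p = ≤-trans (≤-reflexive (cong (λ d → 2 * (d + (deg blockPath y ys + e blockPath ys))) x-ys))
                    (≤-trans IH₁ (n≤1+n _))
      where
      x-ys : deg blockPath x ys ≡ 0
      x-ys = sum-map-zero ys (λ {z} z∈ → indicator-no (path? (toℕ x) (toℕ z)) (λ (z≡ , _) →
               <⇒≱ (All.lookup y< z∈) (≤-trans (≤-reflexive (sym z≡)) x<y)))

  e-matching : ∀ {n} {X : List (Fin n)} → Increasing X → 2 * e blockPath X ≤ length X
  e-matching []        = z≤n
  e-matching ([] ∷ []) = z≤n
  e-matching ((x<y ∷ _) ∷ inc@(y< ∷ inc′)) = e-matching-∷ x<y y< (e-matching inc′) (e-matching inc)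

  -- The exponent 3 reflects that half of `n`, rounded down, is at least a third of `n` once
  -- `n ≥ 2`.
  linear-lower : ∀ {n s t m} → 2 ≤ n → s / 2 ≤ t → IsExΠ n s (s C 2 + t) m → 2 ^ (1 * n) ≤ m ^ 3
  linear-lower {suc n} {s} {t} {m} 2≤n s/2≤t ex = begin
      2 ^ (1 * suc n)              ≤⟨ ^-monoʳ-≤ 2 n≤3E ⟩
      2 ^ (E * 3)                  ≡⟨ sym (^-*-assoc 2 E 3) ⟩
      (2 ^ E) ^ 3                  ≤⟨ ^-monoˡ-≤ 3 (exΠ-≥ ex blockPath blockPath-≤1 sparse) ⟩
      m ^ 3                        ∎
    where
    open ≤-Reasoning
    E : ℕ
    E = e blockPath (allFin (suc n))
    sparse : ∀ X → ∣ X ∣ ≡ s → e blockPath (elems X) ≤ t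
    sparse X len = begin
      e blockPath (elems X)              ≡⟨ sym (m*n/n≡m (e blockPath (elems X)) 2) ⟩
      e blockPath (elems X) * 2 / 2      ≤⟨ /-monoˡ-≤ 2
          (≤-trans (≤-reflexive (*-comm (e blockPath (elems X)) 2)) (e-matching (elems-increasing X))) ⟩
      length (elems X) / 2               ≡⟨ cong (_/ 2) (≡-trans (length-elems X) len) ⟩
      s / 2                              ≤⟨ s/2≤t ⟩
      t                                  ∎
    n≤2E : n ≤ 2 * E
    n≤2E = linear 0 (+-mono-≤ (*-monoʳ-≤ 2 (e-blockPath-≥ n)) (m/n*n≤m n 2)) (arith₁ n E (n / 2))
      where
      arith₁ : ∀ n x h → 2 * x + (2 * n + h * 2) ≡ n + (2 * (x + h) + n) + 0
      arith₁ = solve-∀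
    1≤E : 1 ≤ E
    1≤E = n≢0⇒n>0 (λ E≡0 → contradiction (≤-trans (≤-pred 2≤n) (≤-trans n≤2E (≤-reflexive (cong (2 *_) E≡0)))) λ ())
    n≤3E : 1 * suc n ≤ E * 3
    n≤3E = linear 0 (+-mono-≤ n≤2E 1≤E) (arith n E)
      where
      arith : ∀ n x → x * 3 + (n + 1) ≡ 1 * suc n + (2 * x + x) + 0
      arith = solve-∀

module Bipartite {A : Set} (colour : A → Bool) where

  bipartite : A → A → ℕ
  bipartite x y = if colour x xor colour y then 1 else 0

  bipartite-≤1 : ∀ x y → bipartite x y ≤ 1
  bipartite-≤1 x y with colour x xor colour y
  ... | true  = ≤-refl
  ... | false = z≤n

  #₁ #₀ : List A → ℕ
  #₁ xs = sum (map (λ x → if colour x then 1 else 0) xs)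
  #₀ xs = sum (map (λ x → if colour x then 0 else 1) xs)

  #₁+#₀ : ∀ xs → #₁ xs + #₀ xs ≡ length xs
  #₁+#₀ []       = refl
  #₁+#₀ (x ∷ xs) with colour x
  ... | true  = cong suc (#₁+#₀ xs)
  ... | false = ≡-trans (+-suc (#₁ xs) (#₀ xs)) (cong suc (#₁+#₀ xs))

  e-bipartite : ∀ xs → e bipartite xs ≡ #₁ xs * #₀ xs
  e-bipartite []       = refl
  e-bipartite (x ∷ xs) with colour x
  ... | true  = cong₂ _+_ (sum-map-cong xs (λ {y} _ → not-if (colour y))) (e-bipartite xs)
    where
    not-if : ∀ b → (if not b then 1 else 0) ≡ (if b then 0 else 1)
    not-if true  = refl
    not-if false = refl
  ... | false = ≡-trans (cong (#₁ xs +_) (e-bipartite xs)) (sym (*-suc (#₁ xs) (#₀ xs)))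

  e-bipartite-≤ : ∀ xs → e bipartite xs ≤ (length xs * length xs) / 4
  e-bipartite-≤ xs = ≤-trans (≤-reflexive (sym (m*n/n≡m (e bipartite xs) 4))) (/-monoˡ-≤ 4
    (subst₂ (λ k l → k * 4 ≤ l * l) (sym (e-bipartite xs)) (#₁+#₀ xs) (am-gm (#₁ xs) (#₀ xs))))
    where
    am-gm′ : ∀ a d → a * (a + d) * 4 ≤ (a + (a + d)) * (a + (a + d))
    am-gm′ a d = ≤-trans (m≤m+n _ (d * d)) (≤-reflexive (arith a d))
      where
      arith : ∀ a d → a * (a + d) * 4 + d * d ≡ (a + (a + d)) * (a + (a + d))
      arith = solve-∀
    am-gm : ∀ a b → a * b * 4 ≤ (a + b) * (a + b)
    am-gm a b with ≤-total a b
    ... | inj₁ a≤b with m≤n⇒∃[o]m+o≡n a≤b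
    ...   | d , refl = am-gm′ a d
    am-gm a b | inj₂ b≤a with m≤n⇒∃[o]m+o≡n b≤a
    ...   | d , refl = subst₂ _≤_ (cong (_* 4) (*-comm b (b + d))) (cong (λ k → k * k) (+-comm b (b + d))) (am-gm′ b d)

-- Each colour class contains at least a third of the vertices once `n ≥ 2`, so at least a ninth of
-- `n * n` pairs are edges.
quadratic-lower : ∀ {n s t m} → 2 ≤ n → (s * s) / 4 ≤ t → IsExΠ n s (s C 2 + t) m → 2 ^ (1 * (n * n)) ≤ m ^ 9
quadratic-lower {n} {s} {t} {m} 2≤n s²/4≤t ex = begin
    2 ^ (1 * (n * n))            ≤⟨ ^-monoʳ-≤ 2 (≤-trans (≤-reflexive (*-identityˡ _)) n²≤9E) ⟩
    2 ^ (E * 9)                  ≡⟨ sym (^-*-assoc 2 E 9) ⟩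
    (2 ^ E) ^ 9                  ≤⟨ ^-monoˡ-≤ 9 (exΠ-≥ ex bipartite bipartite-≤1 sparse) ⟩
    m ^ 9                        ∎
  where
  open ≤-Reasoning
  h r : ℕ
  h = n / 2
  r = n % 2
  open Bipartite (λ (i : Fin n) → toℕ i <ᵇ h)
  E : ℕ
  E = e bipartite (allFin n)
  sparse : ∀ X → ∣ X ∣ ≡ s → e bipartite (elems X) ≤ t
  sparse X len = ≤-trans (e-bipartite-≤ (elems X))
      (subst (λ k → (k * k) / 4 ≤ t) (sym (≡-trans (length-elems X) len)) s²/4≤t)
  n≡ : n ≡ r + h * 2
  n≡ = m≡m%n+[m/n]*n n 2
  r≤1 : r ≤ 1
  r≤1 = ≤-pred (m%n<n n 2)
  1≤h : 1 ≤ h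
  1≤h = m≥n⇒m/n>0 2≤n
  #₁≡ : #₁ (allFin n) ≡ h
  #₁≡ = ≡-trans (cong sum (map-tabulate {n = n} id (λ i → if toℕ i <ᵇ h then 1 else 0)))
          (count-below n h (≤-trans (m≤m*n h 2) (m/n*n≤m n 2)))
  #₀≡ : #₀ (allFin n) ≡ h + r
  #₀≡ = +-cancelˡ-≡ h _ _ (≡-trans (cong (_+ #₀ (allFin n)) (sym #₁≡)) (≡-trans (#₁+#₀ (allFin n))
          (≡-trans (length-tabulate id) (≡-trans n≡ (arith h r)))))
    where
    arith : ∀ h r → r + h * 2 ≡ h + (h + r)
    arith = solve-∀
  E≡ : E ≡ h * (h + r)
  E≡ = ≡-trans (e-bipartite (allFin n)) (cong₂ _*_ #₁≡ #₀≡)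
  n²≤9E : n * n ≤ E * 9
  n²≤9E = subst₂ (λ k x → k * k ≤ x * 9) (sym n≡) (sym E≡)
    (linear (5 * (h * h) + 4 * (h * r)) (*-mono-≤ (≤-trans r≤1 1≤h) (≤-refl {r})) (arith h r))
    where
    arith : ∀ h r → h * (h + r) * 9 + r * r ≡ (r + h * 2) * (r + h * 2) + h * r + (5 * (h * h) + 4 * (h * r))
    arith = solve-∀

quadratic-upper : ∀ {n s t m} → 2 ≤ s → s ≤ n → IsExΠ n s (s C 2 + t) m → m ≤ 2 ^ (t * (n * n))
quadratic-upper {n} {s} {t} 2≤s s≤n ex = exΠ-≤ ex bound
  where
  bound : ∀ f → Symm f → Irrefl f → LocalBound f s t (allFin n) → e f (allFin n) ≤ t * (n * n)
  bound f f-sym f-irr sp = begin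
    e f (allFin n)                                       ≤⟨ m≤n*m (e f (allFin n)) 2 ⟩
    2 * e f (allFin n)                                   ≡⟨ sym (handshake f f-sym f-irr (allFin n)) ⟩
    cross f (allFin n) (allFin n)                        ≤⟨ sum-map-≤ _ (allFin n)
        (λ {x} _ → sum-map-≤ t (allFin n) (λ {y} _ → LocalBound⇒weights≤ f-irr 2≤s s≤n sp x y)) ⟩
    length (allFin n) * (length (allFin n) * t)          ≡⟨ cong (λ k → k * (k * t)) (length-tabulate {n = n} id) ⟩
    n * (n * t)                                          ≡⟨ arith n t ⟩
    t * (n * n)                                          ∎
    where
    open ≤-Reasoning
    arith : ∀ n t → n * (n * t) ≡ t * (n * n)
    arith = solve-∀

-- Weakening the local bound to `s − 2` makes `e+2≤length` applicable.
linear-upper : ∀ {n s t m} → t + 2 ≤ s → s ≤ n → IsExΠ n s (s C 2 + t) m → m ≤ 2 ^ (1 * n)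
linear-upper {n} {zero}        {t} t+2≤s s≤n ex = contradiction (≤-trans (m≤n+m 2 t) t+2≤s) λ ()
linear-upper {n} {suc zero}    {t} t+2≤s s≤n ex = contradiction (≤-trans (m≤n+m 2 t) t+2≤s) λ { (s≤s ()) }
linear-upper {n} {suc (suc u)} {t} t+2≤s s≤n ex = exΠ-≤ ex (λ f f-sym f-irr sp → ≤-trans (m≤m+n _ 2) (≤-trans
    (Components.e+2≤length Fin._≟_ f f-sym f-irr u (n ∸ (2 + u)) (allFin n) (Unique.allFin⁺ n)
        (≡-trans len (sym (m+[n∸m]≡n s≤n)))
      (LocalBound-weaken (+-cancelʳ-≤ 2 _ _ (≤-trans t+2≤s (≤-reflexive (+-comm 2 u)))) sp))
    (≤-reflexive (≡-trans len (sym (*-identityˡ n))))))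
  where
  len : length (allFin n) ≡ n
  len = length-tabulate id

-- The forbidden bipartite graph has sides `h` and `h + r`, the two halves of `s`. The threshold is
-- found for the fraction with numerator 1, and a larger `a` only weakens the claim.
subquadratic-upper : ∀ {s t} b → 2 ≤ s → t < (s * s) / 4 → ∃ λ N → ∀ {n m} → N ≤ n → s ≤ n → IsExΠ n s (s C 2 + t) m →
  ∀ a → 1 ≤ a → m ^ suc b ≤ 2 ^ (a * (n * n))
subquadratic-upper {s} {t} b 2≤s t< = N , bound
  where
  h r : ℕ
  h = s / 2
  r = s % 2
  s≡ : s ≡ h + (h + r)
  s≡ = ≡-trans (m≡m%n+[m/n]*n s 2) (arith h r)
    where
    arith : ∀ h r → r + h * 2 ≡ h + (h + r)
    arith = solve-∀
  1≤h : 1 ≤ h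
  1≤h = m≥n⇒m/n>0 2≤s
  s²/4≤ : (s * s) / 4 ≤ h * (h + r)
  -- `s * s` is `4 * (h * (h + r)) + r * r`, and `r * r ≤ 1` is lost in the floor.
  s²/4≤ = ≤-pred (m<n*o⇒m/o<n (subst (λ k → k * k < suc (h * (h + r)) * 4) (sym s≡)
    (linear 2 (*-mono-≤ (≤-pred (m%n<n s 2)) (≤-pred (m%n<n s 2))) (arith h r))))
    where
    arith : ∀ h r → suc (h * (h + r)) * 4 + r * r ≡ suc ((h + (h + r)) * (h + (h + r))) + 1 + 2
    arith = solve-∀
  M N : ℕ
  M = suc (suc b * t) * h
  N = suc b * t * M + M * ((h + r) * 2 ^ M)
  bound : ∀ {n m} → N ≤ n → s ≤ n → IsExΠ n s (s C 2 + t) m → ∀ a → 1 ≤ a → m ^ suc b ≤ 2 ^ (a * (n * n))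
  bound {n} {m} N≤n s≤n ex a 1≤a = begin
    m ^ suc b                                ≤⟨ ^-monoˡ-≤ (suc b) (exΠ-≤ ex few) ⟩
    (2 ^ ((a * (n * n)) / suc b)) ^ suc b    ≡⟨ ^-*-assoc 2 ((a * (n * n)) / suc b) (suc b) ⟩
    2 ^ ((a * (n * n)) / suc b * suc b)      ≤⟨ ^-monoʳ-≤ 2 (m/n*n≤m (a * (n * n)) (suc b)) ⟩
    2 ^ (a * (n * n))                        ∎
    where
    open ≤-Reasoning
    V : List (Fin n)
    V = allFin n
    len : length V ≡ n
    len = length-tabulate id
    few : ∀ f → Symm f → Irrefl f → LocalBound f s t V → e f V ≤ (a * (n * n)) / suc b
    few f f-sym f-irr sp = begin
      e f V                            ≡⟨ sym (m*n/n≡m (e f V) (suc b)) ⟩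
      e f V * suc b / suc b            ≤⟨ /-monoˡ-≤ (suc b) (≤-trans (≤-reflexive (*-comm (e f V) (suc b))) sparse) ⟩
      (a * (n * n)) / suc b            ∎
      where
      sparse : suc b * e f V ≤ a * (n * n)
      sparse = begin
        suc b * e f V          ≤⟨ KőváriSósTurán.biclique-free⇒o[n²] f f-sym f-irr {k = h} {m = h + r}
            {b = suc b} 1≤h (≤-trans 1≤h (m≤m+n h r)) (<-≤-trans t< s²/4≤)
                                   (Unique.allFin⁺ n) (λ {x} {y} _ _ → LocalBound⇒weights≤ f-irr 2≤s s≤n sp x y)
                                       (subst (N ≤_) (sym len) N≤n) (subst (λ k → LocalBound f k t V) s≡ sp) ⟩
        length V * length V    ≡⟨ cong (λ k → k * k) len ⟩
        n * n                  ≤⟨ m≤n*m (n * n) a {{>-nonZero 1≤a}} ⟩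
        a * (n * n)            ∎

-- The eight ranges of q put together.

theorem3p12 : (s q : ℕ) → 2 ≤ s → q ≤ 2 * (s C 2)
    → ((q < s C 2) → (n : ℕ) → s ≤ n → IsExΠ n s q 0)
    × ((q ≡ s C 2) → (n : ℕ) → s ≤ n → IsExΠ n s q 1)
    × ((s C 2 < q) → (q < s C 2 + s / 2) → (n : ℕ) → s ≤ n → IsExΠ n s q (2 ^ (q ∸ s C 2)))
    × ((s C 2 + s / 2 ≤ q) → (q < s C 2 + (s ∸ 2))
    → Σ ℕ λ a₁ → Σ ℕ λ b₁ → Σ ℕ λ a₂ → Σ ℕ λ N → 1 ≤ a₁ × 1 ≤ b₁
    × ((n : ℕ) → N ≤ n → Σ ℕ λ m → IsExΠ n s q m × 2 ^ (a₁ * n) ≤ m ^ b₁ × m ≤ 2 ^ (a₂ * n)))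
    × ((q ≡ s C 2 + (s ∸ 2)) → (n : ℕ) → s ≤ n → IsExΠ n s q (2 ^ divFloor ((s ∸ 2) * n) (s ∸ 1)))
    × ((q ≡ s C 2 + (s ∸ 1)) → (n : ℕ) → s ≤ n → Σ ℕ λ m → IsExCycles n s m × IsExΠ n s q (2 ^ m))
    × ((s C 2 + s ≤ q) → (q < s C 2 + (s * s) / 4)
    → (a b : ℕ) → 1 ≤ a → 1 ≤ b → Σ ℕ λ N
    → (n : ℕ) → N ≤ n → Σ ℕ λ m → IsExΠ n s q m × 1 ≤ m × m ^ b ≤ 2 ^ (a * (n * n)))
    × ((s C 2 + (s * s) / 4 ≤ q)
    → Σ ℕ λ a₁ → Σ ℕ λ b₁ → Σ ℕ λ a₂ → Σ ℕ λ N → 1 ≤ a₁ × 1 ≤ b₁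
    × ((n : ℕ) → N ≤ n → Σ ℕ λ m → IsExΠ n s q m × 2 ^ (a₁ * (n * n)) ≤ m ^ b₁ × m ≤ 2 ^ (a₂ * (n * n))))
theorem3p12 s@(suc (suc u)) q 2≤s@(s≤s (s≤s _)) q≤ =
    (λ q< n s≤n → exΠ-zero 2≤s q< s≤n)
  -- Excess 0 is the smallest instance of the star bound, with value `2 ^ 0`.
  , (λ { refl n s≤n → subst (λ k → IsExΠ n s k 1) (+-identityʳ (s C 2)) (exΠ-few {t = 0} 2≤s s≤n) })
  , small
  , linear-range
  , (λ { refl n s≤n → exΠ-blocks u s≤n })
  , (λ { refl n s≤n → exΠ-cycles (s≤s z≤n) s≤n })
  , subquadratic
  , quadratic
  where
  t : ℕ
  t = q ∸ s C 2

  split : s C 2 ≤ q → s C 2 + t ≡ q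
  split = m+[n∸m]≡n

  t< : ∀ {x} → s C 2 ≤ q → q < s C 2 + x → t < x
  t< le q< = +-cancelˡ-< (s C 2) _ _ (subst (_< _) (sym (split le)) q<)

  ≤t : ∀ {x} → s C 2 + x ≤ q → x ≤ t
  ≤t le = +-cancelˡ-≤ (s C 2) _ _ (subst (_ ≤_) (sym (split (≤-trans (m≤m+n _ _) le))) le)

  small : s C 2 < q → q < s C 2 + s / 2 → (n : ℕ) → s ≤ n → IsExΠ n s q (2 ^ t)
  small C<q q< n s≤n = subst (λ k → IsExΠ n s k (2 ^ t)) (split (<⇒≤ C<q)) (exΠ-few
    (≤-trans (≤-reflexive (arith t)) (≤-trans (*-monoˡ-≤ 2 (t< (<⇒≤ C<q) q<)) (m/n*n≤m s 2))) s≤n)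
    where
    arith : ∀ t → 2 * t + 2 ≡ suc t * 2
    arith = solve-∀

  linear-range : s C 2 + s / 2 ≤ q → q < s C 2 + (s ∸ 2) → Σ ℕ λ a₁ → Σ ℕ λ b₁ → Σ ℕ λ a₂ → Σ ℕ λ N → 1 ≤ a₁ × 1 ≤ b₁
    × ((n : ℕ) → N ≤ n → Σ ℕ λ m → IsExΠ n s q m × 2 ^ (a₁ * n) ≤ m ^ b₁ × m ≤ 2 ^ (a₂ * n))
  -- The lower exponent is `n / 3`, from the matching, and the upper one is `n`.
  linear-range le q< = 1 , 3 , 1 , s , s≤s z≤n , s≤s z≤n , λ n s≤n → let (m , ex-m) = exΠ-exists 2≤s s≤n in
    m , subst (λ k → IsExΠ n s k m) (split C≤q) ex-m ,
    Matching.linear-lower (≤-trans 2≤s s≤n) (≤t le) ex-m ,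
    linear-upper (≤-trans (+-monoˡ-≤ 2 (<⇒≤ (t< C≤q q<))) (≤-reflexive (+-comm u 2))) s≤n ex-m
    where
    C≤q : s C 2 ≤ q
    C≤q = ≤-trans (m≤m+n _ _) le

  subquadratic : s C 2 + s ≤ q → q < s C 2 + (s * s) / 4 → (a b : ℕ) → 1 ≤ a → 1 ≤ b → Σ ℕ λ N
    → (n : ℕ) → N ≤ n → Σ ℕ λ m → IsExΠ n s q m × 1 ≤ m × m ^ b ≤ 2 ^ (a * (n * n))
  -- Adding `s` to the threshold secures the existence of the extremal value.
  subquadratic le q< a (suc b) 1≤a _ = s + proj₁ upper-bound , λ n sN≤n →
    let s≤n = ≤-trans (m≤m+n s _) sN≤n
        (m , ex-m) = exΠ-exists 2≤s s≤n
    in m , subst (λ k → IsExΠ n s k m) (split C≤q) ex-m , positive ex-m ,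
       proj₂ upper-bound (≤-trans (m≤n+m _ s) sN≤n) s≤n ex-m a 1≤a
    where
    C≤q : s C 2 ≤ q
    C≤q = ≤-trans (m≤m+n _ _) le
    upper-bound : ∃ λ N → ∀ {n m} → N ≤ n → s ≤ n → IsExΠ n s (s C 2 + t) m → ∀ a → 1 ≤ a → m ^ suc b ≤ 2 ^
          (a * (n * n))
    upper-bound = subquadratic-upper b 2≤s (t< C≤q q<)
    positive : ∀ {n m} → IsExΠ n s (s C 2 + t) m → 1 ≤ m
    positive {n} ex-m = ≤-trans (m^n>0 2 (e (λ _ _ → 0) (allFin n)))
      (exΠ-≥ ex-m (λ _ _ → 0) (λ _ _ → z≤n) (λ X _ → subst (_≤ t) (sym (e-zero (elems X) (λ _ _ → refl))) z≤n))

  quadratic : s C 2 + (s * s) / 4 ≤ q → Σ ℕ λ a₁ → Σ ℕ λ b₁ → Σ ℕ λ a₂ → Σ ℕ λ N → 1 ≤ a₁ × 1 ≤ b₁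
    × ((n : ℕ) → N ≤ n → Σ ℕ λ m → IsExΠ n s q m × 2 ^ (a₁ * (n * n)) ≤ m ^ b₁ × m ≤ 2 ^ (a₂ * (n * n)))
  -- The lower exponent is a ninth of `n * n`, from the bipartite graph. The upper factor `t` bounds
  -- the excess of a single pair.
  quadratic le = 1 , 9 , t , s , s≤s z≤n , s≤s z≤n , λ n s≤n → let (m , ex-m) = exΠ-exists 2≤s s≤n in
    m , subst (λ k → IsExΠ n s k m) (split (≤-trans (m≤m+n _ _) le)) ex-m ,
    quadratic-lower (≤-trans 2≤s s≤n) (≤t le) ex-m , quadratic-upper 2≤s s≤n ex-m
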